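{- Let $n\ge2$ be an integer that is not of the form $p^k$ ($p$ prime, $k\ge1$), not of the form $pq$ ($p,q$ distinct primes), and not equal to $12$. Then there exists a realizable flag type $T$ of degree $n$ such that \[P_T\not\subseteq\bigcup_{(p_1,\dots,p_t)}P_{T(p_1,\dots,p_t)},\] where the union is over all tuples $(p_1,\dots,p_t)$ of primes with $p_1\cdots p_t=n$.
   Context: Let $[n]=\{0,\dots,n-1\}$. A flag type of degree $n$ is a function $T:[n]\times[n]\to[n]$ such that $T(i,j)=T(j,i)$, $T(i,0)=i$, and $T(i,j)\le T(i+1,j)$ for $i<n-1$. A flag of a finite abelian group $G$ of order $n$ (written multiplicatively) is a chain of subsets $\{1\}=F_0\subset\cdots\subset F_{n-1}=G$ with $|F_i|=i+1$; a flag of a degree $n$ field extension $L/K$ is a chain of $K$-subspaces $K=F_0\subset\cdots\subset F_{n-1}=L$ with $\dim_KF_i=i+1$. The flag type of a flag is $T_{\mathcal F}(i,j)=\min\{k: F_iF_j\subseteq F_k\}$, where $F_iF_j$ is the set of products (groups) or the $K$-span of products (fields). A flag type is realizable if it equals $T_{\mathcal F}$ for some flag of a finite abelian group or finite field extension. $P_T$ is the set of $\mathbf x\in\mathbb R^{n-1}$ with $0\le x_1\le\cdots\le x_{n-1}$ and $x_{T(i,j)}\le x_i+x_j$ for all $1\le i,j<n$. For a tuple $(p_1,\dots,p_t)$ of integers $>1$ with product $n$, write $m\in[n]$ as $m=m_1+m_2p_1+\cdots+m_tp_1\cdots p_{t-1}$ ($0\le m_s<p_s$), let $H=C_{p_1}\times\cdots\times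 C_{p_t}$, $e_s$ a generator of the $s$-th factor, $v_m=e_1^{m_1}\cdots e_t^{m_t}$, $F_m=\{v_0,\dots,v_m\}$; $T(p_1,\dots,p_t)$ is the flag type of this flag of $H$. -}

module Defs where

open import Level using (0ℓ)
open import Data.Nat using (ℕ; zero; suc)
import Data.Nat as N
open import Data.Fin using (Fin; toℕ) renaming (_≤_ to _≤F_; _<_ to _<F_)
import Data.Fin as F
open import Data.List using (List; []; _∷_)
open import Data.Product using (Σ; ∃; _×_; _,_)
open import Data.Sum using (_⊎_)
open import Relation.Nullary using (¬_)
open import Relation.Binary.PropositionalEquality using (_≡_)
open import Algebra.Bundles using (AbelianGroup; CommutativeRing)
import Data.Rational as Q

record FlagType (n : ℕ) : Set where
  field
    T      : Fin n → Fin n → Fin n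
    symm   : ∀ i j → T i j ≡ T j i
    zeroR  : ∀ (z : Fin n) → toℕ z ≡ 0 → ∀ i → T i z ≡ i
    mono   : ∀ (i i' j : Fin n) → toℕ i' ≡ suc (toℕ i) → T i j ≤F T i' j

-- Generic "flag type of a flag": the flag is described by an
-- enumeration g of generators, F_k is determined by the membership
-- predicate In k, and T is the flag type iff T i j is the least k with
-- F_i F_j ⊆ F_k, where (since F_k is closed under the relevant
-- structure) F_i F_j ⊆ F_k  iff  g a ∙ g b ∈ F_k for all a ≤ i, b ≤ j.

ProdSub : {A : Set} {n : ℕ} → (Fin n → A → Set) → (A → A → A) →
          (Fin n → A) → Fin n → Fin n → Fin n → Set
ProdSub In _∙_ g i j k = ∀ (a b : Fin _) → a ≤F i → b ≤F j → In k (g a ∙ g b)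

IsFlagTypeOf : {A : Set} {n : ℕ} → (Fin n → A → Set) → (A → A → A) →
               (Fin n → A) → (Fin n → Fin n → Fin n) → Set
IsFlagTypeOf In _∙_ g T =
  ∀ i j → ProdSub In _∙_ g i j (T i j) × (∀ k → ProdSub In _∙_ g i j k → T i j ≤F k)

-- Flags of finite abelian groups of order n.
-- A flag {1} = F_0 ⊂ ... ⊂ F_{n-1} = G with |F_i| = i+1 is the same as an
-- enumeration g_0 = 1, g_1, ..., g_{n-1} of G without repetition,
-- with F_i = {g_0,...,g_i}.

module _ (G : AbelianGroup 0ℓ 0ℓ) where
  open AbelianGroup G

  InSet : {n : ℕ} → (Fin n → Carrier) → Fin n → Carrier → Set
  InSet g k x = ∃ λ l → l ≤F k × x ≈ g l

  record GroupFlag (n : ℕ) : Set where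
    field
      g     : Fin n → Carrier
      g0    : ∀ (z : Fin n) → toℕ z ≡ 0 → g z ≈ ε
      inj   : ∀ i j → g i ≈ g j → i ≡ j
      surj  : ∀ x → ∃ λ i → x ≈ g i

  GroupFlagType : {n : ℕ} → GroupFlag n → (Fin n → Fin n → Fin n) → Set
  GroupFlagType fl T = IsFlagTypeOf (InSet (GroupFlag.g fl)) _∙_ (GroupFlag.g fl) T

record Field : Set₁ where
  field
    cring  : CommutativeRing 0ℓ 0ℓ
  open CommutativeRing cring public
  field
    1≉0    : ¬ (1# ≈ 0#)
    inv    : ∀ x → ¬ (x ≈ 0#) → ∃ λ y → x * y ≈ 1#

module FieldExt (L : Field) where
  open Field L

  record Subfield (K : Carrier → Set) : Set where
    field
      resp   : ∀ {x y} → x ≈ y → K x → K y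
      has0   : K 0#
      has1   : K 1#
      +-cl   : ∀ {x y} → K x → K y → K (x + y)
      *-cl   : ∀ {x y} → K x → K y → K (x * y)
      neg-cl : ∀ {x} → K x → K (- x)
      inv-cl : ∀ {x y} → K x → x * y ≈ 1# → K y

  sumF : {n : ℕ} → (Fin n → Carrier) → Carrier
  sumF {zero}  f = 0#
  sumF {suc n} f = f F.zero + sumF (λ i → f (F.suc i))

  InSpan : (K : Carrier → Set) {n : ℕ} → (Fin n → Carrier) → Fin n → Carrier → Set
  InSpan K g k x = ∃ λ (c : Fin _ → Carrier) →
    (∀ l → K (c l)) × (∀ l → k <F l → c l ≈ 0#) × x ≈ sumF (λ l → c l * g l)

  -- A flag K = F_0 ⊂ ... ⊂ F_{n-1} = L of K-subspaces with dim F_i = i+1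
  -- is given by a K-basis g_0 = 1, g_1, ..., g_{n-1} of L with
  -- F_i = span_K(g_0,...,g_i); in particular [L : K] = n.
  record FieldFlag (K : Carrier → Set) (n : ℕ) : Set where
    field
      g      : Fin n → Carrier
      g0     : ∀ (z : Fin n) → toℕ z ≡ 0 → g z ≈ 1#
      indep  : ∀ (c : Fin n → Carrier) → (∀ l → K (c l)) →
               sumF (λ l → c l * g l) ≈ 0# → ∀ l → c l ≈ 0#
      span   : ∀ x → ∃ λ (c : Fin n → Carrier) →
               (∀ l → K (c l)) × x ≈ sumF (λ l → c l * g l)

  FieldFlagType : {K : Carrier → Set} {n : ℕ} → FieldFlag K n →
                  (Fin n → Fin n → Fin n) → Set
  FieldFlagType {K} fl T =
    IsFlagTypeOf (InSpan K (FieldFlag.g fl)) _*_ (FieldFlag.g fl) T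

Realizable : {n : ℕ} → FlagType n → Set₁
Realizable {n} T =
  (Σ (AbelianGroup 0ℓ 0ℓ) λ G → Σ (GroupFlag G n) λ fl →
      GroupFlagType G fl (FlagType.T T))
  ⊎
  (Σ Field λ L → Σ (Field.Carrier L → Set) λ K →
     FieldExt.Subfield L K × Σ (FieldExt.FieldFlag L K n) λ fl →
       FieldExt.FieldFlagType L fl (FlagType.T T))

-- The polyhedron P_T (over ℚ).  Vectors x ∈ ℚ^{n-1} are
-- represented as x : Fin n → ℚ whose coordinate x 0 is fixed to 0, so
-- that coordinates 1..n-1 are x_1..x_{n-1}.

InP : {n : ℕ} → (Fin n → Fin n → Fin n) → (Fin n → Q.ℚ) → Set
InP {n} T x =
  (∀ (z : Fin n) → toℕ z ≡ 0 → x z ≡ Q.0ℚ) ×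
  (∀ (i i' : Fin n) → toℕ i' ≡ suc (toℕ i) → x i Q.≤ x i') ×
  (∀ (i j : Fin n) → x (T i j) Q.≤ x i Q.+ x j)

-- The group H = C_{p_1} × ... × C_{p_t} with v_m encoded by m ∈ ℕ via
-- mixed radix digits m = m_1 + m_2 p_1 + ... ; v_a v_b = v_(mulH a b).

modP : ℕ → ℕ → ℕ
modP zero    m = m
modP (suc p) m = N._%_ m (suc p)

divP : ℕ → ℕ → ℕ
divP zero    m = 0
divP (suc p) m = N._/_ m (suc p)

digits : List ℕ → ℕ → List ℕ
digits []       m = []
digits (p ∷ ps) m = modP p m ∷ digits ps (divP p m)

fromDigits : List ℕ → List ℕ → ℕ
fromDigits (p ∷ ps) (d ∷ ds) = d N.+ p N.* fromDigits ps ds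
fromDigits _        _        = 0

addDigits : List ℕ → List ℕ → List ℕ → List ℕ
addDigits (p ∷ ps) (x ∷ xs) (y ∷ ys) = modP p (x N.+ y) ∷ addDigits ps xs ys
addDigits _        _        _        = []

mulH : List ℕ → ℕ → ℕ → ℕ
mulH ps a b = fromDigits ps (addDigits ps (digits ps a) (digits ps b))

InH : {n : ℕ} → Fin n → ℕ → Set
InH {n} k x = ∃ λ (l : Fin n) → l ≤F k × x ≡ toℕ l

IsTp : (ps : List ℕ) {n : ℕ} → (Fin n → Fin n → Fin n) → Set
IsTp ps T = IsFlagTypeOf InH (mulH ps) toℕ T

{-# OPTIONS --safe #-}

-- A point of P_T for the type T of a group flag is a subadditive function on the group, listed in increasing order.
-- It lies in P_{T(p_1,…,p_t)} iff the same increasing list is subadditive for the mixed radix addition of (p_1,…,p_t).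
-- If the values jump by more than a factor 2 at position s, then {0,…,s-1} must be closed under that addition, which forces
-- s to be a partial product p_1⋯p_i. So for n = m n₀ it suffices to treat n₀ (all other elements get one huge value), with
-- only those tuples that have n₀ as a partial product.
--
-- Every n as in the theorem is a multiple of pqr (p ≠ q, r odd), of 4q (q ≥ 5) or of 24, p, q, r prime.
-- In the first case jumps at q and pq leave only tuples (q,p,r,…). Order the coset g K of the subgroup K of order pq so that
-- it begins with a coset of the subgroup P of order p. Then K ∪ gP has pq + p elements and is doubled into
-- K ∪ gK ∪ g²P of 2pq + p elements, while {0,…,p-1} is not closed under the addition of (q,p,r,…).
-- In the other two cases an element x of odd order q costs less than every element outside ⟨x⟩. In the nontrivial coset of a
-- subgroup of index 2 a coset of ⟨x⟩ comes first and the rest costs more than x in addition; the jump is at an odd position t,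
-- where t = 1 + (t - 1) without carry if p_1 = 2. Inside the subgroup, initial segments A + C₂, B + C₂ and A + B + C₂ with
-- |A + B| = |A| + |B| - 1 exclude p_1 = q.

module Submission where

open import Defs
open import Algebra.Bundles using (AbelianGroup)
import Algebra.Construct.DirectProduct as Direct
open import Data.Fin as Fin using (Fin; toℕ; fromℕ; fromℕ<; combine; remQuot)
open import Data.Fin.Patterns
import Data.Fin.Properties as Finₚ
import Data.Integer as ℤ
import Data.Integer.Properties as ℤₚ
open import Data.List using (List; []; _∷_; length; lookup; map)
open import Data.List.Relation.Unary.All using (All; []; _∷_)
open import Data.List.Relation.Unary.Linked using (Linked; [-]; _∷_)
open import Data.Nat as ℕ using (ℕ; zero; suc; _+_; _*_; _^_; _∸_; _≤_; _<_; _≤?_; _<?_; z≤n; s≤s; NonZero)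
open import Data.Nat.Divisibility using (divides; _∣_; ∣1⇒≡1; m∣m*n; ∣n⇒∣m*n)
open import Data.Nat.DivMod
open import Data.Nat.ListAction using (product; sum)
open import Data.Nat.Primality
  using (Prime; prime⇒nonZero; prime⇒nonTrivial; prime⇒irreducible; euclidsLemma; prime[2]; prime?; productOfPrimes≥1)
open import Data.Nat.Primality.Factorisation using (factorise)
open import Data.Nat.Properties
open import Data.Nat.Tactic.RingSolver using (solve-∀)
open import Data.Product using (Σ; ∃; ∃₂; _×_; _,_; proj₁; proj₂; uncurry)
import Data.Rational as Q
open import Data.Rational.Literals using (fromℤ)
import Data.Rational.Properties as Qₚ
import Data.Rational.Unnormalised as Qᵘ
import Data.Rational.Unnormalised.Properties as Qᵘₚ
open import Data.Sum using (_⊎_; inj₁; inj₂)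
open import Data.Vec as Vec using (Vec; []; _∷_)
open import Function using (_∘_)
open import Level using (0ℓ)
open import Relation.Binary.PropositionalEquality
open import Relation.Nullary using (¬_; Dec; yes; no; contradiction; from-yes)
open import Relation.Nullary.Decidable using (_→-dec_)

private variable m n : ℕ

-- Flag types of group flags

-- All points constructed below have natural coordinates, so every estimate is made in ℕ and carried
-- to ℚ only where `InP` is involved.
ι : ℕ → Q.ℚ
ι n = fromℤ (ℤ.+ n)

ι-mono : ∀ {m n} → m ≤ n → ι m Q.≤ ι n
ι-mono m≤n = Q.*≤* (ℤₚ.*-monoʳ-≤-nonNeg (ℤ.+ 1) (ℤ.+≤+ m≤n))

ι-cancel : ∀ {m n} → ι m Q.≤ ι n → m ≤ n
ι-cancel {m} {n} (Q.*≤* p) = ℤ.drop‿+≤+ (ℤₚ.*-cancelʳ-≤-pos (ℤ.+ m) (ℤ.+ n) (ℤ.+ 1) p)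

ι-+ : ∀ m n → ι (m + n) ≡ ι m Q.+ ι n
ι-+ m n = Qₚ.toℚᵘ-injective
  (Qᵘₚ.≃-trans (Qᵘ.*≡* eq) (Qᵘₚ.≃-sym (Qₚ.toℚᵘ-homo-+ (ι m) (ι n))))
  where
  eq : ℤ.+ (m + n) ℤ.* ℤ.+ 1 ≡ (ℤ.+ m ℤ.* ℤ.+ 1 ℤ.+ ℤ.+ n ℤ.* ℤ.+ 1) ℤ.* ℤ.+ 1
  eq = cong (ℤ._* ℤ.+ 1) (sym (cong₂ ℤ._+_ (ℤₚ.*-identityʳ (ℤ.+ m)) (ℤₚ.*-identityʳ (ℤ.+ n))))

ι-≤-+ : ∀ {k m n} → k ≤ m + n → ι k Q.≤ ι m Q.+ ι n
ι-≤-+ {k} {m} {n} p = subst (ι k Q.≤_) (ι-+ m n) (ι-mono p)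

ι-+-≤ : ∀ {k m n} → ι k Q.≤ ι m Q.+ ι n → k ≤ m + n
ι-+-≤ {k} {m} {n} p = ι-cancel (subst (ι k Q.≤_) (sym (ι-+ m n)) p)

least : ∀ {n} (P : Fin n → Set) → (∀ k → Dec (P k)) → ∃ P →
        ∃ λ k → P k × (∀ j → P j → k Fin.≤ j)
least {zero}  P P? (() , _)
least {suc n} P P? (k , pk) with P? Fin.zero
... | yes p0 = Fin.zero , p0 , λ _ _ → z≤n
... | no ¬p0 with k
...   | Fin.zero = contradiction pk ¬p0
...   | Fin.suc k′ with least (P ∘ Fin.suc) (P? ∘ Fin.suc) (k′ , pk)
...     | m , pm , m-least = Fin.suc m , pm , λ where
            Fin.zero    p → contradiction p ¬p0
            (Fin.suc j) p → s≤s (m-least j p)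

-- `index` gives the position of an element in the flag. Having it as data turns the inclusion of
-- F_i F_j in F_k into a decidable condition on positions.
record Enumeration (G : AbelianGroup 0ℓ 0ℓ) (n : ℕ) : Set where
  open AbelianGroup G
  field
    elem       : Fin n → Carrier
    index      : Carrier → Fin n
    index-cong : ∀ {x y} → x ≈ y → index x ≡ index y
    elem-index : ∀ x → elem (index x) ≈ x
    index-elem : ∀ i → index (elem i) ≡ i

record Flag (G : AbelianGroup 0ℓ 0ℓ) (n : ℕ) : Set where
  open AbelianGroup G
  field
    enum    : Enumeration G n
    index-ε : toℕ (Enumeration.index enum ε) ≡ 0
  open Enumeration enum public

-- X i is the value of the i-th group element.
Subadditive : ∀ {G n} → Flag G n → (ℕ → ℕ) → Set
Subadditive {G} F X = ∀ x y → X (toℕ (index (x ∙ y))) ≤ X (toℕ (index x)) + X (toℕ (index y))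
  where open AbelianGroup G; open Flag F

Monotone : (ℕ → ℕ) → Set
Monotone X = ∀ {i j} → i ≤ j → X i ≤ X j

module _ {G : AbelianGroup 0ℓ 0ℓ} {n : ℕ} (F : Flag G n) where
  open AbelianGroup G hiding (refl; sym; trans)
  private module G = AbelianGroup G
  open Flag F

  private
    Bounds : Fin n → Fin n → Fin n → Set
    Bounds i j k = ∀ a b → a Fin.≤ i → b Fin.≤ j → index (elem a ∙ elem b) Fin.≤ k

    bounds? : ∀ i j k → Dec (Bounds i j k)
    bounds? i j k = Finₚ.all? λ a → Finₚ.all? λ b →
      (a Finₚ.≤? i) →-dec ((b Finₚ.≤? j) →-dec (index (elem a ∙ elem b) Finₚ.≤? k))

    top : ∀ {m} → Fin m → Fin m
    top {suc m} _ = fromℕ m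

    ≤-top : ∀ {m} (i k : Fin m) → k Fin.≤ top i
    ≤-top {suc m} _ k = Finₚ.≤fromℕ k

    type : ∀ i j → ∃ λ k → Bounds i j k × (∀ l → Bounds i j l → k Fin.≤ l)
    type i j = least (Bounds i j) (bounds? i j) (top i , λ _ _ _ _ → ≤-top i _)

    T : Fin n → Fin n → Fin n
    T i j = proj₁ (type i j)

    T-bounds : ∀ i j → Bounds i j (T i j)
    T-bounds i j = proj₁ (proj₂ (type i j))

    T-least : ∀ i j k → Bounds i j k → T i j Fin.≤ k
    T-least i j = proj₂ (proj₂ (type i j))

    Bounds-sym : ∀ i j k → Bounds i j k → Bounds j i k
    Bounds-sym i j k p a b a≤j b≤i =
      subst (Fin._≤ k) (index-cong (G.comm (elem b) (elem a))) (p b a b≤i a≤j)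

    elem-zero : ∀ z → toℕ z ≡ 0 → elem z ≈ ε
    elem-zero z z≡0 = G.trans (G.reflexive (cong elem (Finₚ.toℕ-injective (trans z≡0 (sym index-ε)))))
                              (elem-index ε)

    index-∙-zero : ∀ a z → toℕ z ≡ 0 → index (elem a ∙ elem z) ≡ a
    index-∙-zero a z z≡0 = trans
      (index-cong (G.trans (G.∙-congˡ (elem-zero z z≡0)) (G.identityʳ (elem a)))) (index-elem a)

    groupFlag : GroupFlag G n
    groupFlag = record
      { g    = elem
      ; g0   = elem-zero
      ; inj  = λ i j e → trans (sym (index-elem i)) (trans (index-cong e) (index-elem j))
      ; surj = λ x → index x , G.sym (elem-index x)
      }

  flagType : FlagType n
  flagType = record
    { T     = T
    ; symm  = λ i j → Finₚ.≤-antisym (T-least i j _ (Bounds-sym j i _ (T-bounds j i)))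
                                     (T-least j i _ (Bounds-sym i j _ (T-bounds i j)))
    ; zeroR = λ z z≡0 i → Finₚ.≤-antisym
        (T-least i z i λ a b a≤i b≤z →
          subst (Fin._≤ i) (sym (index-∙-zero a b (n≤0⇒n≡0 (subst (toℕ b ≤_) z≡0 b≤z)))) a≤i)
        (subst (Fin._≤ T i z) (index-∙-zero i z z≡0) (T-bounds i z i z ≤-refl ≤-refl))
    ; mono  = λ i i' j i'≡1+i → T-least i j (T i' j) λ a b a≤i b≤j →
        T-bounds i' j a b (≤-trans a≤i (subst (toℕ i ≤_) (sym i'≡1+i) (n≤1+n _))) b≤j
    }

  flagType-realizable : Realizable flagType
  flagType-realizable = inj₁ (G , groupFlag , λ i j →
    (λ a b a≤i b≤j → index (elem a ∙ elem b) , T-bounds i j a b a≤i b≤j , G.sym (elem-index _)) ,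
    (λ k p → T-least i j k λ a b a≤i b≤j → case-∈ (p a b a≤i b≤j)))
    where
    case-∈ : ∀ {x k} → (∃ λ l → l Fin.≤ k × x ≈ elem l) → index x Fin.≤ k
    case-∈ {k = k} (l , l≤k , x≈) = subst (Fin._≤ k) (sym (trans (index-cong x≈) (index-elem l))) l≤k

  private
    -- If X (T i j) exceeded X i + X j, the predecessor of T i j would already bound F_i F_j.
    X-T : ∀ X → Monotone X → X 0 ≡ 0 → Subadditive F X → ∀ i j → X (toℕ (T i j)) ≤ X (toℕ i) + X (toℕ j)
    X-T X mono X0 sub i j with X (toℕ (T i j)) ≤? X (toℕ i) + X (toℕ j)
    ... | yes p = p
    ... | no ¬p = go (T i j) refl
      where
      below : ∀ a b → a Fin.≤ i → b Fin.≤ j → index (elem a ∙ elem b) Fin.< T i j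
      below a b a≤i b≤j = ≰⇒> λ T≤ → ¬p (≤-trans (mono T≤) (≤-trans (sub (elem a) (elem b))
        (+-mono-≤ (mono (subst (Fin._≤ i) (sym (index-elem a)) a≤i))
                  (mono (subst (Fin._≤ j) (sym (index-elem b)) b≤j)))))
      go : ∀ t → T i j ≡ t → X (toℕ (T i j)) ≤ X (toℕ i) + X (toℕ j)
      go Fin.zero    e = subst (_≤ X (toℕ i) + X (toℕ j)) (sym (trans (cong (X ∘ toℕ) e) X0)) z≤n
      go (Fin.suc t) e = contradiction (T-least i j (Fin.inject₁ t) λ a b a≤i b≤j →
          subst (toℕ (index (elem a ∙ elem b)) ≤_) (sym (Finₚ.toℕ-inject₁ t))
            (≤-pred (subst (index (elem a ∙ elem b) Fin.<_) e (below a b a≤i b≤j))))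
        (subst₂ (λ u v → ¬ (toℕ u ≤ v)) (sym e) (sym (Finₚ.toℕ-inject₁ t)) 1+n≰n)

  InP-flagType : ∀ X → Monotone X → X 0 ≡ 0 → Subadditive F X → InP (FlagType.T flagType) (ι ∘ X ∘ toℕ)
  InP-flagType X mono X0 sub =
    (λ z z≡0 → trans (cong (ι ∘ X) z≡0) (cong ι X0)) ,
    (λ i i' e → ι-mono (mono (subst (toℕ i ≤_) (sym e) (n≤1+n _)))) ,
    λ i j → ι-≤-+ {m = X (toℕ i)} (X-T X mono X0 sub i j)

-- The bound `s` is independent of `product ps`, so that the condition can be restricted to an
-- initial segment.
TowerSubadditive : List ℕ → ℕ → (ℕ → ℕ) → Set
TowerSubadditive ps s X = ∀ a b → a < s → b < s → X (mulH ps a b) ≤ X a + X b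

-- The element `mulH ps a b` lies in F_a F_b, so its position is at most T′(a, b). Monotonicity of
-- `X` turns the inequality at T′(a, b) into one at the product itself.
InP-tower : ∀ {n} X → Monotone X → ∀ ps (T′ : Fin n → Fin n → Fin n) → IsTp ps T′ →
            InP T′ (ι ∘ X ∘ toℕ) → TowerSubadditive ps n X
InP-tower X mono ps T′ isT (_ , _ , inP) a b a<n b<n
  with l , l≤T , eq ← proj₁ (isT (fromℕ< a<n) (fromℕ< b<n)) _ _ ≤-refl ≤-refl
  = subst₂ (λ u v → X (mulH ps u v) ≤ X u + X v) (Finₚ.toℕ-fromℕ< a<n) (Finₚ.toℕ-fromℕ< b<n)
      (≤-trans (≤-trans (≤-reflexive (cong X eq)) (mono l≤T))
        (ι-+-≤ {m = X (toℕ (fromℕ< a<n))} (inP (fromℕ< a<n) (fromℕ< b<n))))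

-- Cyclic groups and orders on their products

module _ (n : ℕ) .{{_ : NonZero n}} where
  private
    infixl 6 _⊕_
    _⊕_ : Fin n → Fin n → Fin n
    a ⊕ b = (toℕ a + toℕ b) mod n

    ⊖_ : Fin n → Fin n
    ⊖ a = (n ∸ toℕ a) mod n

    toℕ-mod : ∀ k → toℕ (k mod n) ≡ k % n
    toℕ-mod k = Finₚ.toℕ-fromℕ< (m%n<n k n)

    %-absorbˡ : ∀ k l → (k % n + l) % n ≡ (k + l) % n
    %-absorbˡ k l = begin
      (k % n + l) % n             ≡⟨ %-distribˡ-+ (k % n) l n ⟩
      (k % n % n + l % n) % n     ≡⟨ cong (λ h → (h + l % n) % n) (m%n%n≡m%n k n) ⟩
      (k % n + l % n) % n         ≡⟨ %-distribˡ-+ k l n ⟨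
      (k + l) % n                 ∎
      where open ≡-Reasoning

    %-absorbʳ : ∀ k l → (k + l % n) % n ≡ (k + l) % n
    %-absorbʳ k l = trans (cong (_% n) (+-comm k (l % n))) (trans (%-absorbˡ l k) (cong (_% n) (+-comm l k)))

    ⊕-comm : ∀ a b → a ⊕ b ≡ b ⊕ a
    ⊕-comm a b = cong (_mod n) (+-comm (toℕ a) (toℕ b))

    ⊕-assoc : ∀ a b c → (a ⊕ b) ⊕ c ≡ a ⊕ (b ⊕ c)
    ⊕-assoc a b c = Finₚ.toℕ-injective (begin
      toℕ ((a ⊕ b) ⊕ c)                    ≡⟨ toℕ-mod _ ⟩
      (toℕ (a ⊕ b) + toℕ c) % n            ≡⟨ cong (λ h → (h + toℕ c) % n) (toℕ-mod _) ⟩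
      ((toℕ a + toℕ b) % n + toℕ c) % n    ≡⟨ %-absorbˡ _ _ ⟩
      (toℕ a + toℕ b + toℕ c) % n          ≡⟨ cong (_% n) (+-assoc (toℕ a) _ _) ⟩
      (toℕ a + (toℕ b + toℕ c)) % n        ≡⟨ %-absorbʳ _ _ ⟨
      (toℕ a + (toℕ b + toℕ c) % n) % n    ≡⟨ cong (λ h → (toℕ a + h) % n) (toℕ-mod _) ⟨
      (toℕ a + toℕ (b ⊕ c)) % n            ≡⟨ toℕ-mod _ ⟨
      toℕ (a ⊕ (b ⊕ c))                    ∎)
      where open ≡-Reasoning

    ⊕-identityˡ : ∀ a → (0 mod n) ⊕ a ≡ a
    ⊕-identityˡ a = Finₚ.toℕ-injective (begin
      toℕ ((0 mod n) ⊕ a)          ≡⟨ toℕ-mod _ ⟩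
      (toℕ (0 mod n) + toℕ a) % n  ≡⟨ cong (λ h → (h + toℕ a) % n) (toℕ-mod 0) ⟩
      (0 % n + toℕ a) % n          ≡⟨ %-absorbˡ 0 (toℕ a) ⟩
      toℕ a % n                    ≡⟨ m<n⇒m%n≡m (Finₚ.toℕ<n a) ⟩
      toℕ a                        ∎)
      where open ≡-Reasoning

    ⊖-inverseˡ : ∀ a → (⊖ a) ⊕ a ≡ 0 mod n
    ⊖-inverseˡ a = Finₚ.toℕ-injective (begin
      toℕ ((⊖ a) ⊕ a)                ≡⟨ toℕ-mod _ ⟩
      (toℕ (⊖ a) + toℕ a) % n        ≡⟨ cong (λ h → (h + toℕ a) % n) (toℕ-mod _) ⟩
      ((n ∸ toℕ a) % n + toℕ a) % n  ≡⟨ %-absorbˡ _ _ ⟩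
      (n ∸ toℕ a + toℕ a) % n        ≡⟨ cong (_% n) (m∸n+n≡m (<⇒≤ (Finₚ.toℕ<n a))) ⟩
      n % n                          ≡⟨ n%n≡0 n ⟩
      0                              ≡⟨ 0%n ⟨
      0 % n                          ≡⟨ toℕ-mod 0 ⟨
      toℕ (0 mod n)                  ∎)
      where
      open ≡-Reasoning
      0%n : 0 % n ≡ 0
      0%n = n≤0⇒n≡0 (m%n≤m 0 n)

  cyclic : AbelianGroup 0ℓ 0ℓ
  cyclic = record
    { Carrier = Fin n ; _≈_ = _≡_ ; _∙_ = _⊕_ ; ε = 0 mod n ; _⁻¹ = ⊖_
    ; isAbelianGroup = record
      { isGroup = record
        { isMonoid = record
          { isSemigroup = record
            { isMagma = record { isEquivalence = isEquivalence ; ∙-cong = cong₂ _⊕_ }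
            ; assoc = ⊕-assoc }
          ; identity = ⊕-identityˡ , λ a → trans (⊕-comm a _) (⊕-identityˡ a) }
        ; inverse = ⊖-inverseˡ , λ a → trans (⊕-comm a _) (⊖-inverseˡ a)
        ; ⁻¹-cong = cong ⊖_ }
      ; comm = ⊕-comm }
    }

  toℕ-⊕ : ∀ a b → toℕ (AbelianGroup._∙_ cyclic a b) ≡ (toℕ a + toℕ b) % n
  toℕ-⊕ a b = toℕ-mod _

  toℕ-ε : toℕ (AbelianGroup.ε cyclic) ≡ 0
  toℕ-ε = trans (toℕ-mod 0) (n≤0⇒n≡0 (m%n≤m 0 n))

  ⊕-< : ∀ a b → toℕ a + toℕ b < n → toℕ (AbelianGroup._∙_ cyclic a b) ≡ toℕ a + toℕ b
  ⊕-< a b p = trans (toℕ-⊕ a b) (m<n⇒m%n≡m p)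

infixr 2 _⊗_
_⊗_ : AbelianGroup 0ℓ 0ℓ → AbelianGroup 0ℓ 0ℓ → AbelianGroup 0ℓ 0ℓ
_⊗_ = Direct.abelianGroup

lex : .{{_ : NonZero m}} .{{_ : NonZero n}} → Enumeration (cyclic m ⊗ cyclic n) (m * n)
lex {m} {n} = record
  { elem       = remQuot n
  ; index      = uncurry combine
  ; index-cong = λ (e , e′) → cong₂ combine e e′
  ; elem-index = λ (i , j) → let e = Finₚ.remQuot-combine {m} {n} i j in cong proj₁ e , cong proj₂ e
  ; index-elem = Finₚ.combine-remQuot {m} n
  }

colex : .{{_ : NonZero m}} .{{_ : NonZero n}} → Enumeration (cyclic m ⊗ cyclic n) (m * n)
colex {m} {n} = record
  { elem       = λ k → let (j , i) = remQuot m (Fin.cast (*-comm m n) k) in i , j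
  ; index      = λ (i , j) → Fin.cast (*-comm n m) (combine j i)
  ; index-cong = λ (e , e′) → cong (Fin.cast _) (cong₂ combine e′ e)
  ; elem-index = λ (i , j) →
      let e = trans (cong (remQuot m) (Finₚ.cast-involutive (*-comm m n) (*-comm n m) (combine j i)))
                    (Finₚ.remQuot-combine {n} {m} j i)
      in cong proj₂ e , cong proj₁ e
  ; index-elem = λ k → trans (cong (Fin.cast _) (Finₚ.combine-remQuot {n} m (Fin.cast (*-comm m n) k)))
                             (Finₚ.cast-involutive (*-comm n m) (*-comm m n) k)
  }

toℕ-lex : .{{_ : NonZero m}} .{{_ : NonZero n}} → ∀ i j →
          toℕ (Enumeration.index (lex {m} {n}) (i , j)) ≡ n * toℕ i + toℕ j
toℕ-lex = Finₚ.toℕ-combine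

toℕ-colex : .{{_ : NonZero m}} .{{_ : NonZero n}} → ∀ i j →
            toℕ (Enumeration.index (colex {m} {n}) (i , j)) ≡ m * toℕ j + toℕ i
toℕ-colex {m} {n} i j = trans (Finₚ.toℕ-cast _ (combine j i)) (Finₚ.toℕ-combine j i)

module _ {G : AbelianGroup 0ℓ 0ℓ} where
  private module G = AbelianGroup G
  open G using (Carrier; _≈_)

  precompose : Enumeration G n → (σ : Carrier → Carrier) →
               (∀ {x y} → x ≈ y → σ x ≈ σ y) → (∀ x → σ (σ x) ≈ x) → Enumeration G n
  precompose E σ σ-cong σ-invol = record
    { elem       = σ ∘ elem
    ; index      = index ∘ σ
    ; index-cong = index-cong ∘ σ-cong
    ; elem-index = λ x → G.trans (σ-cong (elem-index (σ x))) (σ-invol x)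
    ; index-elem = λ i → trans (index-cong (σ-invol (elem i))) (index-elem i)
    }
    where open Enumeration E

-- The cosets of `G` follow one another, but each may carry its own order; the witnesses for 4q and
-- pqr rest on orders that differ between cosets.
cosetwise : ∀ {G} m .{{_ : NonZero m}} → (Fin m → Enumeration G n) → Enumeration (cyclic m ⊗ G) (m * n)
cosetwise {n} {G} m E = record
  { elem       = λ k → let (c , i) = remQuot n k in c , elem (E c) i
  ; index      = λ (c , x) → combine c (index (E c) x)
  ; index-cong = λ { {c , x} (refl , e′) → cong (combine c) (index-cong (E c) e′) }
  ; elem-index = λ (c , x) → elem-index′ c x
  ; index-elem = λ k → let (c , i) = remQuot n k in
      trans (cong (combine c) (index-elem (E c) i)) (Finₚ.combine-remQuot {m} n k)
  }
  where
  open Enumeration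
  module G = AbelianGroup G
  elem-index′ : ∀ c x → let (c′ , i) = remQuot {m} n (combine c (index (E c) x)) in
                c′ ≡ c × elem (E c′) i G.≈ x
  elem-index′ c x = subst (λ (c′ , i) → c′ ≡ c × elem (E c′) i G.≈ x)
    (sym (Finₚ.remQuot-combine {m} {n} c (index (E c) x))) (refl , elem-index (E c) x)

module _ {G m} .{{_ : NonZero m}} (E : Fin m → Enumeration G n) where
  open AbelianGroup G using (Carrier)
  open Enumeration

  toℕ-cosetwise : ∀ c (x : Carrier) → toℕ (index (cosetwise {n} {G} m E) (c , x)) ≡ n * toℕ c + toℕ (index (E c) x)
  toℕ-cosetwise c x = Finₚ.toℕ-combine c (index (E c) x)

  cosetwise-≥ : ∀ c (x : Carrier) → n * toℕ c ≤ toℕ (index (cosetwise {n} {G} m E) (c , x))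
  cosetwise-≥ c x = subst (n * toℕ c ≤_) (sym (toℕ-cosetwise c x)) (m≤m+n _ _)

  cosetwise-< : ∀ c (x : Carrier) → toℕ (index (cosetwise {n} {G} m E) (c , x)) < n * suc (toℕ c)
  cosetwise-< c x = subst₂ _<_ (sym (toℕ-cosetwise c x)) (trans (+-comm (n * toℕ c) n) (sym (*-suc n (toℕ c))))
    (+-monoʳ-< (n * toℕ c) (Finₚ.toℕ<n (index (E c) x)))

-- Mixed radix addition

divP-modP : ∀ p .{{_ : NonZero p}} d m → d < p → modP p (d + p * m) ≡ d × divP p (d + p * m) ≡ m
divP-modP p@(suc _) d m d<p rewrite *-comm p m =
  trans ([m+kn]%n≡m%n d m p) (m<n⇒m%n≡m d<p) ,
  trans (+-distrib-/-∣ʳ d (divides m refl)) (cong₂ _+_ (m<n⇒m/n≡0 d<p) (m*n/n≡m m p))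

modP-< : ∀ {p d} → d < p → modP p d ≡ d
modP-< {suc p} d<p = m<n⇒m%n≡m d<p

mulH-∷ : ∀ p .{{_ : NonZero p}} ps {d e} m k → d < p → e < p →
         mulH (p ∷ ps) (d + p * m) (e + p * k) ≡ modP p (d + e) + p * mulH ps m k
mulH-∷ p ps {d} {e} m k d<p e<p
  with eq₁ , eq₂ ← divP-modP p d m d<p | eq₃ , eq₄ ← divP-modP p e k e<p
  rewrite eq₁ | eq₂ | eq₃ | eq₄ = refl

mulH-no-carry : ∀ p .{{_ : NonZero p}} ps {d e} m k → d + e < p →
                mulH (p ∷ ps) (d + p * m) (e + p * k) ≡ (d + e) + p * mulH ps m k
mulH-no-carry p ps {d} {e} m k d+e<p =
  trans (mulH-∷ p ps m k (≤-<-trans (m≤m+n d e) d+e<p) (≤-<-trans (m≤n+m e d) d+e<p))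
        (cong (_+ p * mulH ps m k) (modP-< d+e<p))

-- The bound on m reflects that `digits` drops whatever is left after the last radix.
mulH-identityˡ : ∀ ps → All Prime ps → m < product ps → mulH ps 0 m ≡ m
mulH-identityˡ {zero}  []       []          _ = refl
mulH-identityˡ {suc m} []       []          (s≤s ())
mulH-identityˡ {m}     (p ∷ ps) (pr ∷ prs) m<Π = begin
  mulH (p ∷ ps) 0 m                                ≡⟨ cong₂ (mulH (p ∷ ps)) (sym (*-zeroʳ p)) m-eq ⟩
  mulH (p ∷ ps) (0 + p * 0) (m % p + p * (m / p))  ≡⟨ mulH-no-carry p ps 0 (m / p) (m%n<n m p) ⟩
  m % p + p * mulH ps 0 (m / p)                    ≡⟨ cong (λ h → m % p + p * h) (mulH-identityˡ ps prs m/p<Π) ⟩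
  m % p + p * (m / p)                              ≡⟨ m-eq ⟨
  m                                                ∎
  where
  open ≡-Reasoning
  instance _ = prime⇒nonZero pr
  m-eq : m ≡ m % p + p * (m / p)
  m-eq = trans (m≡m%n+[m/n]*n m p) (cong (m % p +_) (*-comm (m / p) p))
  m/p<Π : m / p < product ps
  m/p<Π = m<n*o⇒m/o<n (subst (m <_) (*-comm p (product ps)) m<Π)

Closed : List ℕ → ℕ → Set
Closed ps s = ∀ a b → a < s → b < s → mulH ps a b < s

-- If s = d + p s' with 0 < d < p, then s is reached as 1 + (d - 1) when s' = 0
-- and exceeded by (p - 1) + p s' otherwise.
closed-∷ : ∀ {p ps s} → Prime p → All Prime ps → 2 ≤ s → s ≤ p * product ps → Closed (p ∷ ps) s →
           ∃ λ s′ → s ≡ p * s′ × Closed ps s′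
closed-∷ {p} {ps} {s} pr prs 2≤s s≤Π closed = s / p , s≡p*s′ , closed′
  where
  instance _ = prime⇒nonZero pr
  s-eq : s ≡ s % p + p * (s / p)
  s-eq = trans (m≡m%n+[m/n]*n s p) (cong (s % p +_) (*-comm (s / p) p))

  no-remainder : ∀ d s′ → s ≡ suc d + p * s′ → suc d < p → ¬ (s′ < product ps)
  no-remainder d zero eq 1+d<p _ = <-irrefl refl (≤-<-trans s≤ (closed 1 d 2≤s d<s))
    where
    s≡1+d : s ≡ suc d
    s≡1+d = trans eq (trans (cong (suc d +_) (*-zeroʳ p)) (+-identityʳ (suc d)))
    d<s : d < s
    d<s = ≤-reflexive (sym s≡1+d)
    s≤ : s ≤ mulH (p ∷ ps) 1 d
    s≤ = begin
      s                                          ≡⟨ s≡1+d ⟩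
      1 + d                                      ≤⟨ m≤m+n (1 + d) _ ⟩
      1 + d + p * mulH ps 0 0                    ≡⟨ mulH-no-carry p ps {1} {d} 0 0 1+d<p ⟨
      mulH (p ∷ ps) (1 + p * 0) (d + p * 0)      ≡⟨ cong₂ (mulH (p ∷ ps)) (+p*0 1) (+p*0 d) ⟩
      mulH (p ∷ ps) 1 d                          ∎
      where
      open ≤-Reasoning
      +p*0 : ∀ k → k + p * 0 ≡ k
      +p*0 k = trans (cong (k +_) (*-zeroʳ p)) (+-identityʳ k)
  no-remainder d s′@(suc _) eq 1+d<p s′<Π =
    <-irrefl refl (<-≤-trans (closed (ℕ.pred p) (p * s′) p-1<s ps′<s) s≤)
    where
    p-1<p : ℕ.pred p < p
    p-1<p = ≤-reflexive (suc-pred p)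
    ps′<s : p * s′ < s
    ps′<s = subst (p * s′ <_) (sym eq) (s≤s (m≤n+m (p * s′) d))
    p-1<s : ℕ.pred p < s
    p-1<s = <-≤-trans p-1<p (≤-trans (m≤m*n p s′) (<⇒≤ ps′<s))
    s≤ : s ≤ mulH (p ∷ ps) (ℕ.pred p) (p * s′)
    s≤ = begin
      s                                                  ≡⟨ eq ⟩
      suc d + p * s′                                     ≤⟨ +-monoˡ-≤ (p * s′) (<⇒≤pred 1+d<p) ⟩
      ℕ.pred p + p * s′                                  ≡⟨ cong₂ (λ u v → u + p * v) (+-identityʳ (ℕ.pred p)) (mulH-identityˡ ps prs s′<Π) ⟨
      ℕ.pred p + 0 + p * mulH ps 0 s′                    ≡⟨ mulH-no-carry p ps 0 s′ (subst (_< p) (sym (+-identityʳ (ℕ.pred p))) p-1<p) ⟨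
      mulH (p ∷ ps) (ℕ.pred p + p * 0) (0 + p * s′)      ≡⟨ cong (λ u → mulH (p ∷ ps) u (p * s′)) (trans (cong (ℕ.pred p +_) (*-zeroʳ p)) (+-identityʳ (ℕ.pred p))) ⟩
      mulH (p ∷ ps) (ℕ.pred p) (p * s′)                  ∎
      where open ≤-Reasoning

  s≡p*s′ : s ≡ p * (s / p)
  s≡p*s′ with s % p in eq
  ... | zero  = trans s-eq (cong (_+ p * (s / p)) eq)
  ... | suc d = contradiction s′<Π (no-remainder d (s / p) s-eq′ 1+d<p)
    where
    1+d<p : suc d < p
    1+d<p = subst (_< p) eq (m%n<n s p)
    s-eq′ : s ≡ suc d + p * (s / p)
    s-eq′ = trans s-eq (cong (_+ p * (s / p)) eq)
    s′<Π : s / p < product ps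
    s′<Π = *-cancelˡ-< p _ _ (<-≤-trans (subst (p * (s / p) <_) (sym s-eq′) (s≤s (m≤n+m _ d))) s≤Π)

  -- The numbers below `s` with first digit 0 are the p a with a < s / p, and these are added by
  -- `ps` alone.
  closed′ : Closed ps (s / p)
  closed′ a b a<s′ b<s′ = *-cancelˡ-< p _ _ (subst₂ _<_
    (mulH-no-carry p ps {0} {0} a b (ℕ.>-nonZero⁻¹ p)) s≡p*s′
    (closed (p * a) (p * b) (lift a<s′) (lift b<s′)))
    where
    lift : ∀ {k} → k < s / p → p * k < s
    lift k<s′ = subst (p * _ <_) (sym s≡p*s′) (*-monoʳ-< p k<s′)

-- By `closed-∷` the first radix divides the closed size q, and q is the only prime that does.
closed-prime : ∀ {p ps q} → Prime p → All Prime ps → Prime q → q ≤ p * product ps → Closed (p ∷ ps) q → p ≡ q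
closed-prime {p} {ps} {q} pr prs prq q≤Π closed
  with s′ , eq , _ ← closed-∷ pr prs (ℕ.nonTrivial⇒n>1 q {{prime⇒nonTrivial prq}}) q≤Π closed
  with prime⇒irreducible prq (divides s′ (trans eq (*-comm p s′)))
... | inj₁ refl = contradiction (ℕ.nonTrivial⇒n>1 1 {{prime⇒nonTrivial pr}}) λ { (s≤s ()) }
... | inj₂ p≡q  = p≡q

-- Step functions with prescribed jumps

-- staircase ((t₁ , w₁) ∷ (t₂ , w₂) ∷ …) jumps by wₖ at tₖ.
staircase : List (ℕ × ℕ) → ℕ → ℕ
staircase []            i = 0
staircase ((t , w) ∷ l) i with i <? t
... | yes _ = 0
... | no  _ = w + staircase l i

staircase-mono : ∀ l → Monotone (staircase l)
staircase-mono []            i≤j = z≤n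
staircase-mono ((t , w) ∷ l) {i} {j} i≤j with i <? t | j <? t
... | yes _   | _       = z≤n
... | no  i≮t | yes j<t = contradiction (≤-<-trans i≤j j<t) i≮t
... | no  _   | no  _   = +-monoʳ-≤ w (staircase-mono l i≤j)

height : (l : List (ℕ × ℕ)) → Fin (length l) → ℕ
height (_       ∷ l) Fin.zero    = 0
height ((_ , w) ∷ l) (Fin.suc k) = w + height l k

-- The sum stops at the first threshold above i. If i < tₖ, this happens before wₖ is added,
-- whatever the order of the thresholds.
staircase-upper : ∀ l k {i} → i < proj₁ (lookup l k) → staircase l i ≤ height l k
staircase-upper ((t , w) ∷ l) k {i} i<tₖ with i <? t
staircase-upper ((t , w) ∷ l) k           i<tₖ | yes _   = z≤n
staircase-upper ((t , w) ∷ l) Fin.zero    i<tₖ | no  i≮t = contradiction i<tₖ i≮t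
staircase-upper ((t , w) ∷ l) (Fin.suc k) i<tₖ | no  _   = +-monoʳ-≤ w (staircase-upper l k i<tₖ)

Ascending : List (ℕ × ℕ) → Set
Ascending = Linked (λ (t , _) (t′ , _) → t ≤ t′)

ascending-head : ∀ {t w l} → Ascending ((t , w) ∷ l) → ∀ k → t ≤ proj₁ (lookup ((t , w) ∷ l) k)
ascending-head asc          Fin.zero    = ≤-refl
ascending-head (t≤t′ ∷ asc) (Fin.suc k) = ≤-trans t≤t′ (ascending-head asc k)

-- In an ascending list, an i that has reached tₖ has reached all earlier thresholds too, so the sum
-- does not stop before wₖ.
staircase-lower : ∀ {l} → Ascending l → ∀ k {i} → proj₁ (lookup l k) ≤ i →
                  height l k + proj₂ (lookup l k) ≤ staircase l i
staircase-lower {(t , w) ∷ l} asc k {i} tₖ≤i with i <? t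
... | yes i<t = contradiction (≤-<-trans (≤-trans (ascending-head asc k) tₖ≤i) i<t) (<-irrefl refl)
staircase-lower {(t , w) ∷ l} asc          Fin.zero    tₖ≤i | no _ = m≤m+n w _
staircase-lower {(t , w) ∷ l} (_ ∷ asc)    (Fin.suc k) {i} tₖ≤i | no _ =
  subst (_≤ w + staircase l i) (sym (+-assoc w (height l k) _)) (+-monoʳ-≤ w (staircase-lower asc k tₖ≤i))

staircase-≤-sum : ∀ l i → staircase l i ≤ sum (map proj₂ l)
staircase-≤-sum []            i = z≤n
staircase-≤-sum ((t , w) ∷ l) i with i <? t
... | yes _ = z≤n
... | no  _ = +-monoʳ-≤ w (staircase-≤-sum l i)

-- Passing to multiples

Uncovered : ℕ → Set₁
Uncovered n = Σ (FlagType n) λ T → Realizable T ×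
  (∃ λ (x : Fin n → Q.ℚ) → InP (FlagType.T T) x ×
    ((ps : List ℕ) → All Prime ps → product ps ≡ n →
      (T' : Fin n → Fin n → Fin n) → IsTp ps T' → ¬ InP T' x))

-- Only tuples with n as a partial product have to be excluded, so that a witness for n serves all multiples of n.
record Witness (n : ℕ) : Set₁ where
  field
    {G}         : AbelianGroup 0ℓ 0ℓ
    flag        : Flag G n
    X           : ℕ → ℕ
    X-mono      : Monotone X
    X-zero      : X 0 ≡ 0
    subadditive : Subadditive flag X
    obstruction : ∀ ps → All Prime ps → n ≤ product ps → Closed ps n → ¬ TowerSubadditive ps n X

module _ {G : AbelianGroup 0ℓ 0ℓ} (F : Flag G n) (X : ℕ → ℕ) where
  private module G = AbelianGroup G
  open G using (_∙_; _≈_; ε)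
  open Flag F

  -- Position 0 holds the identity, for which the inequality is trivial. In the remaining pairs both
  -- summands have at least the value at position 1.
  subadditive-off-zero :
    (∀ x y → 1 ≤ toℕ (index x) → 1 ≤ toℕ (index y) →
      X (toℕ (index (x ∙ y))) ≤ X (toℕ (index x)) + X (toℕ (index y))) →
    Subadditive F X
  subadditive-off-zero sub x y = go (toℕ (index x)) (toℕ (index y)) refl refl
    where
    trivial : ∀ z → toℕ (index z) ≡ 0 → z ≈ ε
    trivial z e = G.trans (G.sym (elem-index z)) (G.trans
      (G.reflexive (cong elem (Finₚ.toℕ-injective (trans e (sym index-ε))))) (elem-index ε))
    go : ∀ i j → i ≡ toℕ (index x) → j ≡ toℕ (index y) →
         X (toℕ (index (x ∙ y))) ≤ X (toℕ (index x)) + X (toℕ (index y))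
    go zero    _       i≡ _  = ≤-trans
      (≤-reflexive (cong (X ∘ toℕ) (index-cong (G.trans (G.∙-congʳ (trivial x (sym i≡))) (G.identityˡ y)))))
      (m≤n+m _ _)
    go (suc _) zero    _  j≡ = ≤-trans
      (≤-reflexive (cong (X ∘ toℕ) (index-cong (G.trans (G.∙-congˡ (trivial y (sym j≡))) (G.identityʳ x)))))
      (m≤m+n _ _)
    go (suc _) (suc _) i≡ j≡ = sub x y (subst (1 ≤_) i≡ (s≤s z≤n)) (subst (1 ≤_) j≡ (s≤s z≤n))

-- Only the order on the subgroup c = 0 has to begin with the identity; the other cosets may be
-- ordered freely.
cosetwise-flag : ∀ {G} m .{{_ : NonZero m}} (E : Fin m → Enumeration G n) →
                 (∀ c → toℕ c ≡ 0 → toℕ (Enumeration.index (E c) (AbelianGroup.ε G)) ≡ 0) →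
                 Flag (cyclic m ⊗ G) (m * n)
cosetwise-flag {n} {G} m E e = record
  { enum    = cosetwise {n} {G} m E
  ; index-ε = trans (toℕ-cosetwise {n} {G} E (AbelianGroup.ε (cyclic m)) (AbelianGroup.ε G))
      (trans (cong₂ (λ u v → n * u + v) (toℕ-ε m) (e _ (toℕ-ε m))) (trans (+-identityʳ _) (*-zeroʳ n)))
  }

-- The value from position n on exceeds the sum of any two values below n, for which `X n` is a
-- common upper bound.
extend : ℕ → (ℕ → ℕ) → ℕ → ℕ
extend n X i with i <? n
... | yes _ = X i
... | no  _ = suc (X n + X n)

module _ {n : ℕ} {X : ℕ → ℕ} (X-mono : Monotone X) where

  extend-< : ∀ {i} → i < n → extend n X i ≡ X i
  extend-< {i} i<n with i <? n
  ... | yes _   = refl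
  ... | no  i≮n = contradiction i<n i≮n

  extend-≥ : ∀ {i} → n ≤ i → extend n X i ≡ suc (X n + X n)
  extend-≥ {i} n≤i with i <? n
  ... | yes i<n = contradiction (≤-<-trans n≤i i<n) (<-irrefl refl)
  ... | no  _   = refl

  extend-≤ : ∀ i → extend n X i ≤ suc (X n + X n)
  extend-≤ i with i <? n
  ... | yes i<n = ≤-trans (X-mono (<⇒≤ i<n)) (≤-trans (m≤m+n _ _) (n≤1+n _))
  ... | no  _   = ≤-refl

  extend-mono : Monotone (extend n X)
  extend-mono {i} {j} i≤j with j <? n
  ... | no  _   = extend-≤ i
  ... | yes j<n = ≤-trans (≤-reflexive (extend-< (≤-<-trans i≤j j<n))) (X-mono i≤j)

-- In C_m × G the subgroup G comes first. A sum with a summand outside G is harmless, since that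
-- summand already has the largest value; sums within G stay there. For a tuple, the jump at n makes
-- {0,...,n-1} closed, and the obstruction of the witness applies.
witness⇒uncovered : ∀ m n .{{_ : NonZero m}} .{{_ : NonZero n}} → Witness n → Uncovered (m * n)
witness⇒uncovered m n W = flagType F , flagType-realizable F , _ ,
  InP-flagType F X′ mono (trans (extend-< X-mono (ℕ.>-nonZero⁻¹ n)) X-zero) sub ,
  λ ps prs Π≡ T′ isT inP → not-tower ps prs Π≡ (InP-tower X′ mono ps T′ isT inP)
  where
  open Witness W
  module G = AbelianGroup G
  open Flag flag using (index)
  E : Fin m → Enumeration G n
  E _ = Flag.enum flag
  F : Flag (cyclic m ⊗ G) (m * n)
  F = cosetwise-flag {G = G} m E λ _ _ → Flag.index-ε flag
  X′ : ℕ → ℕ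
  X′ = extend n X
  mono : Monotone X′
  mono = extend-mono {n} X-mono

  idx : Fin m × G.Carrier → ℕ
  idx z = toℕ (Flag.index F z)

  inner : ∀ c x → idx (c , x) < n → toℕ c ≡ 0
  inner c x p = n<1⇒n≡0 (*-cancelˡ-< n _ _ (≤-<-trans (cosetwise-≥ {n} {G} E c x) (subst (idx (c , x) <_) (sym (*-identityʳ n)) p)))

  idx-inner : ∀ c x → toℕ c ≡ 0 → idx (c , x) ≡ toℕ (index x)
  idx-inner c x c≡0 = trans (toℕ-cosetwise {n} {G} E c x)
    (cong (_+ toℕ (index x)) (trans (cong (n *_) c≡0) (*-zeroʳ n)))

  X′-inner : ∀ c x → toℕ c ≡ 0 → X′ (idx (c , x)) ≡ X (toℕ (index x))
  X′-inner c x c≡0 = trans (cong X′ (idx-inner c x c≡0)) (extend-< X-mono (Finₚ.toℕ<n (index x)))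

  outer : ∀ {i j} → n ≤ i → X′ j ≤ X′ i
  outer n≤i = ≤-trans (extend-≤ X-mono _) (≤-reflexive (sym (extend-≥ X-mono n≤i)))

  sub : Subadditive F X′
  sub z@(c , x) w@(d , y) = go (<-≤-connex (idx z) n) (<-≤-connex (idx w) n)
    where
    module C = AbelianGroup (cyclic m)
    go : idx z < n ⊎ n ≤ idx z → idx w < n ⊎ n ≤ idx w →
         X′ (idx (c C.∙ d , x G.∙ y)) ≤ X′ (idx z) + X′ (idx w)
    go (inj₂ z≥) _         = ≤-trans (outer z≥) (m≤m+n _ _)
    go (inj₁ _)  (inj₂ w≥) = ≤-trans (outer w≥) (m≤n+m _ _)
    go (inj₁ z<) (inj₁ w<) = subst₂ _≤_ (sym (X′-inner (c C.∙ d) (x G.∙ y) c+d≡0))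
      (cong₂ _+_ (sym (X′-inner c x c≡0)) (sym (X′-inner d y d≡0))) (subadditive x y)
      where
      c≡0 = inner c x z<
      d≡0 = inner d y w<
      c+d≡0 : toℕ (c C.∙ d) ≡ 0
      c+d≡0 = trans (⊕-< m c d (subst₂ (λ u v → u + v < m) (sym c≡0) (sym d≡0) (ℕ.>-nonZero⁻¹ m)))
                    (cong₂ _+_ c≡0 d≡0)

  not-tower : ∀ ps → All Prime ps → product ps ≡ m * n → ¬ TowerSubadditive ps (m * n) X′
  not-tower ps prs Π≡ tower = obstruction ps prs (≤-trans n≤mn (≤-reflexive (sym Π≡))) closed
    λ a b a<n b<n → subst₂ _≤_ (extend-< X-mono (closed a b a<n b<n))
      (cong₂ _+_ (extend-< X-mono a<n) (extend-< X-mono b<n)) (tower a b (<-≤-trans a<n n≤mn) (<-≤-trans b<n n≤mn))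
    where
    n≤mn : n ≤ m * n
    n≤mn = m≤n*m n m
    closed : Closed ps n
    closed a b a<n b<n with mulH ps a b <? n
    ... | yes p = p
    ... | no ¬p = contradiction (begin-strict
      X n + X n                <⟨ ≤-refl ⟩
      suc (X n + X n)          ≡⟨ extend-≥ X-mono (≮⇒≥ ¬p) ⟨
      X′ (mulH ps a b)         ≤⟨ tower a b (<-≤-trans a<n n≤mn) (<-≤-trans b<n n≤mn) ⟩
      X′ a + X′ b              ≡⟨ cong₂ _+_ (extend-< X-mono a<n) (extend-< X-mono b<n) ⟩
      X a + X b                ≤⟨ +-mono-≤ (X-mono (<⇒≤ a<n)) (X-mono (<⇒≤ b<n)) ⟩
      X n + X n                ∎) (<-irrefl refl)
      where open ≤-Reasoning

-- The case 24

module _ (s t : ℕ) where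
  -- The values 0, 4, 5, 6, 8, 12, 17, the latter two starting at 2 + s and t.
  steps : List (ℕ × ℕ)
  steps = (1 , 4) ∷ (2 , 1) ∷ (4 , 1) ∷ (s , 2) ∷ (2 + s , 4) ∷ (t , 5) ∷ []

  steps-ascending : 4 ≤ s → 2 + s ≤ t → Ascending steps
  steps-ascending 4≤s 2+s≤t =
    s≤s z≤n ∷ s≤s (s≤s z≤n) ∷ 4≤s ∷ m≤n+m s 2 ∷ 2+s≤t ∷ [-]

-- X (t - 1) + X 1 ≤ 12 + 4 < 17 ≤ X t.
even-head-obstruction : ∀ s t j ps → 4 ≤ s → 2 + s ≤ t → t ≡ 1 + 2 * j → All Prime ps → j < product ps →
  ∀ {n} → t ≤ n → ¬ TowerSubadditive (2 ∷ ps) n (staircase (steps s t))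
even-head-obstruction s t j ps 4≤s s≤t refl prs j<Π {n} t≤n tower = contradiction (begin
  17                                       ≤⟨ staircase-lower (steps-ascending s t 4≤s s≤t) 5F ≤-refl ⟩
  X (1 + 2 * j)                            ≡⟨ cong X (trans (mulH-no-carry 2 ps {1} {0} 0 j ≤-refl) (cong (λ h → 1 + 2 * h) (mulH-identityˡ ps prs j<Π))) ⟨
  X (mulH (2 ∷ ps) 1 (2 * j))              ≤⟨ tower 1 (2 * j) (<-≤-trans (s≤s (s≤s z≤n)) (≤-trans (≤-trans 4≤s (≤-trans (m≤n+m s 2) s≤t)) t≤n)) t≤n ⟩
  X 1 + X (2 * j)                          ≤⟨ +-mono-≤ (staircase-upper (steps s t) 1F ≤-refl) (staircase-upper (steps s t) 5F ≤-refl) ⟩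
  16                                       ∎) λ p → 1+n≰n p
  where
  open ≤-Reasoning
  X = staircase (steps s t)

-- X (s + 2) ≥ 12 > 5 + 6 ≥ X 3 + X (s - 1).
product-obstruction : ∀ s t ps {n} → 4 ≤ suc s → 3 + s ≤ t → 3 + s ≤ n → mulH ps 3 s ≡ 3 + s →
  ¬ TowerSubadditive ps n (staircase (steps (suc s) t))
product-obstruction s t ps 4≤s s≤t s≤n eq tower = contradiction (begin
  12                ≤⟨ staircase-lower (steps-ascending (suc s) t 4≤s s≤t) 4F ≤-refl ⟩
  X (3 + s)         ≡⟨ cong X eq ⟨
  X (mulH ps 3 s)   ≤⟨ tower 3 s (<-≤-trans (m<m+n 3 (≤-trans (s≤s z≤n) (≤-pred 4≤s))) s≤n) (<-≤-trans (m<n+m s (s≤s z≤n)) s≤n) ⟩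
  X 3 + X s         ≤⟨ +-mono-≤ (staircase-upper (steps (suc s) t) 2F ≤-refl) (staircase-upper (steps (suc s) t) 3F ≤-refl) ⟩
  11                ∎) 1+n≰n
  where
  open ≤-Reasoning
  X = staircase (steps (suc s) t)

-- Prime divisors of closed sizes, and the witness of order 24

prime[3] : Prime 3
prime[3] = from-yes (prime? 3)

prime>1 : ∀ {p} → Prime p → 1 < p
prime>1 {p} pr = ℕ.nonTrivial⇒n>1 p {{prime⇒nonTrivial pr}}

prime∣prime : ∀ {p q} → Prime p → Prime q → p ∣ q → p ≡ q
prime∣prime prp prq p∣q with prime⇒irreducible prq p∣q
... | inj₁ refl = contradiction (prime>1 prp) λ { (s≤s ()) }
... | inj₂ p≡q  = p≡q

prime∣2^* : ∀ {p} k m → Prime p → p ∣ 2 ^ k * m → p ≡ 2 ⊎ p ∣ m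
prime∣2^* {p} zero    m pr p∣ = inj₂ (subst (p ∣_) (*-identityˡ m) p∣)
prime∣2^* {p} (suc k) m pr p∣ with euclidsLemma 2 (2 ^ k * m) pr (subst (p ∣_) (*-assoc 2 (2 ^ k) m) p∣)
... | inj₁ p∣2 = inj₁ (prime∣prime pr prime[2] p∣2)
... | inj₂ p∣m = prime∣2^* k m pr p∣m

closed-head∣ : ∀ {p ps s} → Prime p → All Prime ps → 2 ≤ s → s ≤ p * product ps → Closed (p ∷ ps) s → p ∣ s
closed-head∣ {p} pr prs 2≤s s≤Π closed with s′ , eq , _ ← closed-∷ pr prs 2≤s s≤Π closed =
  divides s′ (trans eq (*-comm p s′))

-- With x = 8, u = 12 and g = 6, of orders 3, 2 and 4 (2g = u), the values are
-- 4: x;  5: {0,x} + u;  6: {2x,g} + ⟨u⟩;  8: g + x + ⟨u⟩;  12: g + 2x + ⟨u⟩ and 3 + ⟨x⟩;  17: the other odd elements.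
order : Vec ℕ 24
order = 0 ∷ 8 ∷ 12 ∷ 20 ∷ 16 ∷ 4 ∷ 6 ∷ 18 ∷ 14 ∷ 2 ∷ 22 ∷ 10 ∷ 3 ∷ 11 ∷ 19 ∷
        1 ∷ 5 ∷ 7 ∷ 9 ∷ 13 ∷ 15 ∷ 17 ∷ 21 ∷ 23 ∷ []

-- The inverse permutation of `order`, tabulated so that both composites are checked by evaluation.
position : Vec ℕ 24
position = 0 ∷ 15 ∷ 9 ∷ 12 ∷ 5 ∷ 16 ∷ 6 ∷ 17 ∷ 1 ∷ 18 ∷ 11 ∷ 13 ∷ 2 ∷ 19 ∷ 8 ∷ 20 ∷
           4 ∷ 21 ∷ 7 ∷ 14 ∷ 3 ∷ 22 ∷ 10 ∷ 23 ∷ []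

flag₂₄ : Flag (cyclic 24) 24
flag₂₄ = record
  { enum = record
    { elem       = elem
    ; index      = index
    ; index-cong = cong index
    ; elem-index = from-yes (Finₚ.all? λ x → elem (index x) Finₚ.≟ x)
    ; index-elem = from-yes (Finₚ.all? λ x → index (elem x) Finₚ.≟ x)
    }
  ; index-ε = refl
  }
  where
  elem index : Fin 24 → Fin 24
  elem  i = Vec.lookup order i mod 24
  index x = Vec.lookup position x mod 24

witness₂₄ : Witness 24
witness₂₄ = record
  { flag        = flag₂₄
  ; X           = staircase (steps 8 15)
  ; X-mono      = staircase-mono (steps 8 15)
  ; X-zero      = refl
  ; subadditive = from-yes (Finₚ.all? λ x → Finₚ.all? λ y → X (index (x ∙ y)) ≤? X (index x) + X (index y))
  ; obstruction = obstruction
  }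
  where
  open AbelianGroup (cyclic 24) using (_∙_)
  open Flag flag₂₄ using () renaming (index to idx)
  index : Fin 24 → ℕ
  index x = toℕ (idx x)
  X = staircase (steps 8 15)
  2≤ : ∀ {k} → 2 ≤ suc (suc k)
  2≤ = s≤s (s≤s z≤n)

  obstruction-3 : ∀ ps → All Prime ps → 8 ≤ product ps → Closed ps 8 → ¬ TowerSubadditive (3 ∷ ps) 24 X
  obstruction-3 []       _          (s≤s ()) _
  obstruction-3 (p ∷ ps) (pr ∷ prs) 8≤Π closed
    with prime∣2^* 3 1 pr (closed-head∣ pr prs 2≤ 8≤Π closed)
  ... | inj₂ p∣1  = contradiction (∣1⇒≡1 p∣1) λ { refl → <-irrefl refl (prime>1 pr) }
  -- In the radices (3, 2, ...) the digits of 3 are (0, 1, 0) and those of 7 = 1 + 3 · 2 are (1, 0,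
  -- 1), so the sum is 10 without carry.
  ... | inj₁ refl = product-obstruction 7 15 (3 ∷ 2 ∷ ps) (m≤m+n 4 4) (m≤m+n 10 5) (m≤m+n 10 14)
      (cong (λ h → 1 + 3 * (1 + 2 * h)) (mulH-identityˡ ps prs (<-≤-trans 2≤ (*-cancelˡ-≤ {4} 2 8≤Π))))

  -- The first radix divides 24. A 2 conflicts with the jump at the odd position 15 = 1 + 2 · 7.
  -- After a 3, the closed size 24 / 3 = 8 forces the next radix to be 2.
  obstruction : ∀ ps → All Prime ps → 24 ≤ product ps → Closed ps 24 → ¬ TowerSubadditive ps 24 X
  obstruction []       _          (s≤s ()) _
  obstruction (p ∷ ps) (pr ∷ prs) 24≤Π closed
    with prime∣2^* 3 3 pr (closed-head∣ pr prs 2≤ 24≤Π closed)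
  ... | inj₁ refl = even-head-obstruction 8 15 7 ps (m≤m+n 4 4) (m≤m+n 10 5) refl prs
        (<-≤-trans (m≤m+n 8 4) (*-cancelˡ-≤ {12} 2 24≤Π)) (m≤m+n 15 9)
  ... | inj₂ p∣3 with refl ← prime∣prime pr prime[3] p∣3
        with s′ , eq , closed′ ← closed-∷ pr prs 2≤ 24≤Π closed
        with refl ← *-cancelˡ-≡ 8 s′ 3 eq = obstruction-3 ps prs (*-cancelˡ-≤ 3 24≤Π) closed′

-- The case 4q

-- The elements are (f , e , k). For f = 0 the value is 4 at x = (0 , 1), 5 on the rest of C₂ × {0,1}, 6 on the rest of
-- C₂ × {0,…,h}, 8 on C₂ × {h+1} and 12 beyond; for f = 1 it is 12 if e = 0 and 17 if e = 1.
module FourPrimes (h′ : ℕ) where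
  -- Here h = (q - 1) / 2, and the offset 2 expresses q ≥ 5.
  h q : ℕ
  h = 2 + h′
  q = 1 + 2 * h

  Base Whole : AbelianGroup 0ℓ 0ℓ
  Base  = cyclic 2 ⊗ cyclic q
  Whole = cyclic 2 ⊗ Base

  -- x = (0 , 1) has to precede (1 , 0), unlike in the colexicographic order.
  swap : Fin 2 × Fin q → Fin 2 × Fin q
  swap (0F , 1F) = 1F , 0F
  swap (1F , 0F) = 0F , 1F
  swap z         = z

  swap-involutive : ∀ z → let (e , k) = swap (swap z) in e ≡ proj₁ z × k ≡ proj₂ z
  swap-involutive (0F , 0F)                = refl , refl
  swap-involutive (0F , 1F)                = refl , refl
  swap-involutive (0F , Fin.suc (Fin.suc _)) = refl , refl
  swap-involutive (1F , 0F)                = refl , refl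
  swap-involutive (1F , Fin.suc _)         = refl , refl

  -- In the subgroup f = 0 the sets C₂ × {0,...,k} with k ≥ 1 are initial segments. The coset f = 1
  -- begins with a coset of ⟨x⟩.
  E : Fin 2 → Enumeration Base (2 * q)
  E 0F = precompose colex swap (λ { (refl , refl) → refl , refl }) swap-involutive
  E 1F = lex

  flag : Flag Whole (2 * (2 * q))
  flag = cosetwise-flag {G = Base} 2 E λ where
    0F _  → toℕ-colex {2} {q} 0F 0F
    1F ()

  open AbelianGroup Whole using (_∙_)

  opaque
    index : Fin 2 × Fin 2 × Fin q → ℕ
    index z = toℕ (Flag.index flag z)

  opaque
    unfolding index

    index-0 : ∀ z → index (0F , z) ≡ toℕ (Enumeration.index (E 0F) z)
    index-0 z = trans (toℕ-cosetwise {2 * q} {Base} E 0F z) (cong (_+ toℕ (Enumeration.index (E 0F) z)) (*-zeroʳ (2 * q)))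
    
    index-1 : ∀ e k → index (1F , e , k) ≡ 2 * q + (q * toℕ e + toℕ k)
    index-1 e k = trans (toℕ-cosetwise {2 * q} {Base} E 1F (e , k)) (cong₂ _+_ (*-identityʳ (2 * q)) (toℕ-lex {2} {q} e k))

  index-large : ∀ e (k : Fin q) → 2 ≤ toℕ k → index (0F , e , k) ≡ 2 * toℕ k + toℕ e
  index-large e 0F ()
  index-large e 1F (s≤s ())
  index-large 0F k@(Fin.suc (Fin.suc _)) _ = trans (index-0 (0F , k)) (toℕ-colex {2} {q} 0F k)
  index-large 1F k@(Fin.suc (Fin.suc _)) _ = trans (index-0 (1F , k)) (toℕ-colex {2} {q} 1F k)

  index-small : ∀ e (k : Fin q) → toℕ k < 2 → index (0F , e , k) < 4
  index-small 0F 0F _ = s≤s (≤-trans (≤-reflexive (trans (index-0 (0F , 0F)) (toℕ-colex {2} {q} 0F 0F))) z≤n)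
  index-small 0F 1F _ = s≤s (≤-trans (≤-reflexive (trans (index-0 (0F , 1F)) (toℕ-colex {2} {q} 1F 0F))) (s≤s z≤n))
  index-small 1F 0F _ = s≤s (≤-trans (≤-reflexive (trans (index-0 (1F , 0F)) (toℕ-colex {2} {q} 0F 1F))) (s≤s (s≤s z≤n)))
  index-small 1F 1F _ = s≤s (≤-reflexive (trans (index-0 (1F , 1F)) (toℕ-colex {2} {q} 1F 1F)))
  index-small e (Fin.suc (Fin.suc k)) (s≤s (s≤s ()))

  index-1F-≥2 : ∀ (k : Fin q) → 2 ≤ index (0F , 1F , k)
  index-1F-≥2 0F = ≤-reflexive (sym (trans (index-0 (1F , 0F)) (toℕ-colex {2} {q} 0F 1F)))
  index-1F-≥2 1F = ≤-trans (n≤1+n 2) (≤-reflexive (sym (trans (index-0 (1F , 1F)) (toℕ-colex {2} {q} 1F 1F))))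
  index-1F-≥2 k@(Fin.suc (Fin.suc _)) = subst (2 ≤_) (sym (index-large 1F k (s≤s (s≤s z≤n))))
    (≤-trans (*-monoʳ-≤ 2 {1} {toℕ k} (s≤s z≤n)) (m≤m+n (2 * toℕ k) 1))

  -- Since 1 + q = 2(h + 1), the numbers `s` and 2 + `s` are the sizes of C₂ × {0,...,h} and C₂ ×
  -- {0,...,h+1}. At `t` = 2q + q the first coset of ⟨x⟩ outside the subgroup f = 0 ends.
  s t : ℕ
  s = 1 + q
  t = 3 * q

  opaque
    X : ℕ → ℕ
    X = staircase (steps s t)

  4≤s : 4 ≤ s
  4≤s = m≤m+n 4 _

  s+2≤t : 2 + s ≤ t
  s+2≤t = m+n≤o⇒m≤o (2 + s) (≤-reflexive (eq h′))
    where
    eq : ∀ h′ → 3 + (1 + 2 * (2 + h′)) + (7 + 4 * h′) ≡ 3 * (1 + 2 * (2 + h′))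
    eq = solve-∀

  opaque
    unfolding X
    lower : ∀ k {i} → proj₁ (lookup (steps s t) k) ≤ i → height (steps s t) k + proj₂ (lookup (steps s t) k) ≤ X i
    lower = staircase-lower (steps-ascending s t 4≤s s+2≤t)

    upper : ∀ k {i} → i < proj₁ (lookup (steps s t) k) → X i ≤ height (steps s t) k
    upper = staircase-upper (steps s t)

    X≤17 : ∀ i → X i ≤ 17
    X≤17 = staircase-≤-sum (steps s t)

  private
    toℕ≤1 : (e : Fin 2) → toℕ e ≤ 1
    toℕ≤1 e = ≤-pred (Finₚ.toℕ<n e)

  0-coset≤12 : ∀ z → X (index (0F , z)) ≤ 12
  0-coset≤12 z = upper 5F (<-≤-trans (subst (_< 2 * q) (sym (index-0 z)) (Finₚ.toℕ<n _)) (m≤n+m (2 * q) q))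

  1-coset≥12 : ∀ z → 12 ≤ X (index (1F , z))
  1-coset≥12 (e , k) = lower 4F (begin
    2 + s                                 ≡⟨⟩
    3 + q                                 ≤⟨ +-monoˡ-≤ q {3} {q} (s≤s (m≤m+n 2 _)) ⟩
    q + q                                 ≡⟨ cong (q +_) (+-identityʳ q) ⟨
    2 * q                                 ≤⟨ m≤m+n (2 * q) _ ⟩
    2 * q + (q * toℕ e + toℕ k)           ≡⟨ index-1 e k ⟨
    index (1F , e , k)                    ∎)
    where open ≤-Reasoning

  large-k : ∀ e (k : Fin q) → 2 ≤ toℕ k → 6 ≤ X (index (0F , e , k))
  large-k e k 2≤k = lower 2F (subst (4 ≤_) (sym (index-large e k 2≤k)) (≤-trans (*-monoʳ-≤ 2 2≤k) (m≤m+n _ _)))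

  larger-k : ∀ e (k : Fin q) → h < toℕ k → 8 ≤ X (index (0F , e , k))
  larger-k e k h<k = lower 3F (subst (s ≤_) (sym (index-large e k (≤-trans (s≤s (s≤s z≤n)) h<k)))
    (≤-trans (≤-trans (≤-reflexive (sym (*-suc 2 h))) (*-monoʳ-≤ 2 h<k)) (m≤m+n _ _)))

  moderate-k : ∀ e (k : Fin q) → toℕ k ≤ 1 + h → X (index (0F , e , k)) ≤ 8
  moderate-k e k k≤1+h with <-≤-connex (toℕ k) 2
  ... | inj₁ k<2 = ≤-trans (upper 2F (index-small e k k<2)) (m≤m+n 5 3)
  ... | inj₂ 2≤k = upper 4F (subst (_< 2 + s) (sym (index-large e k 2≤k)) (begin-strict
        2 * toℕ k + toℕ e   ≤⟨ +-mono-≤ (*-monoʳ-≤ 2 k≤1+h) (toℕ≤1 e) ⟩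
        2 * (1 + h) + 1     ≡⟨ cong (_+ 1) (*-suc 2 h) ⟩
        2 + 2 * h + 1       ≡⟨ +-comm (2 + 2 * h) 1 ⟩
        3 + 2 * h           <⟨ ≤-refl ⟩
        2 + s               ∎))
    where open ≤-Reasoning

  private
    module E₂ = AbelianGroup (cyclic 2)
    module K = AbelianGroup (cyclic q)

  -- Either both summands lie outside {0,1} × C_2, or one of them lies in it and the other
  -- inside or outside {0,…,h} × C_2: 6 + 6, 4 + 4 and 4 + 8 suffice respectively.
  subadditive-0 : ∀ e k e′ k′ → 1 ≤ index (0F , e , k) → 1 ≤ index (0F , e′ , k′) →
    X (index (0F , e E₂.∙ e′ , k K.∙ k′)) ≤ X (index (0F , e , k)) + X (index (0F , e′ , k′))
  subadditive-0 e k e′ k′ z≥1 z′≥1 = go (<-≤-connex (toℕ k) 2) (<-≤-connex (toℕ k′) 2)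
    (<-≤-connex h (toℕ k)) (<-≤-connex h (toℕ k′))
    where
    k+k′ : toℕ k + toℕ k′ ≤ 1 + h → toℕ (k K.∙ k′) ≤ 1 + h
    k+k′ p = ≤-trans (≤-reflexive (⊕-< q k k′ (≤-<-trans p 1+h<q))) p
      where
      1+h<q : 1 + h < q
      1+h<q = s≤s (m<m+n h (s≤s z≤n))
    go : toℕ k < 2 ⊎ 2 ≤ toℕ k → toℕ k′ < 2 ⊎ 2 ≤ toℕ k′ →
         h < toℕ k ⊎ toℕ k ≤ h → h < toℕ k′ ⊎ toℕ k′ ≤ h →
         X (index (0F , e E₂.∙ e′ , k K.∙ k′)) ≤ X (index (0F , e , k)) + X (index (0F , e′ , k′))
    go (inj₂ 2≤k) (inj₂ 2≤k′) _ _ =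
      ≤-trans (0-coset≤12 (e E₂.∙ e′ , k K.∙ k′)) (+-mono-≤ (large-k e k 2≤k) (large-k e′ k′ 2≤k′))
    go (inj₁ k<2) _ _ (inj₂ k′≤h) =
      ≤-trans (moderate-k (e E₂.∙ e′) (k K.∙ k′) (k+k′ (+-mono-≤ (≤-pred k<2) k′≤h)))
              (+-mono-≤ (lower 0F z≥1) (lower 0F z′≥1))
    go (inj₁ k<2) _ _ (inj₁ h<k′) =
      ≤-trans (0-coset≤12 (e E₂.∙ e′ , k K.∙ k′)) (+-mono-≤ (lower 0F z≥1) (larger-k e′ k′ h<k′))
    go _ (inj₁ k′<2) (inj₂ k≤h) _ =
      ≤-trans (moderate-k (e E₂.∙ e′) (k K.∙ k′) (k+k′ (≤-trans (+-mono-≤ k≤h (≤-pred k′<2)) (≤-reflexive (+-comm h 1)))))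
              (+-mono-≤ (lower 0F z≥1) (lower 0F z′≥1))
    go _ (inj₁ k′<2) (inj₁ h<k) _ =
      ≤-trans (0-coset≤12 (e E₂.∙ e′ , k K.∙ k′)) (+-mono-≤ (larger-k e k h<k) (lower 0F z′≥1))

  -- From value 12 at e′ = 0, the value 17 is reached only by adding an element with e = 1. Such an
  -- element has position at least 2, thanks to `swap`, hence value at least 5, and 5 + 12 = 17.
  subadditive-01 : ∀ e k e′ k′ →
    X (index (1F , e E₂.∙ e′ , k K.∙ k′)) ≤ X (index (0F , e , k)) + X (index (1F , e′ , k′))
  subadditive-01 0F k 0F k′ = ≤-trans
    (upper 5F (subst (_< t) (sym (index-1 0F (k K.∙ k′))) (begin-strict
      2 * q + (q * 0 + toℕ (k K.∙ k′))   ≡⟨ cong (λ u → 2 * q + (u + toℕ (k K.∙ k′))) (*-zeroʳ q) ⟩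
      2 * q + toℕ (k K.∙ k′)             <⟨ +-monoʳ-< (2 * q) (Finₚ.toℕ<n (k K.∙ k′)) ⟩
      2 * q + q                          ≡⟨ +-comm (2 * q) q ⟩
      t                                  ∎)))
    (≤-trans (1-coset≥12 (0F , k′)) (m≤n+m _ _))
    where open ≤-Reasoning
  subadditive-01 1F k 0F k′ = ≤-trans (X≤17 _) (+-mono-≤ (lower 1F (index-1F-≥2 k)) (1-coset≥12 (0F , k′)))
  subadditive-01 e k 1F k′ = ≤-trans (X≤17 _) (≤-trans (lower 5F (begin
      t                                  ≡⟨ +-comm q (2 * q) ⟩
      2 * q + q                          ≡⟨ cong (2 * q +_) (*-identityʳ q) ⟨
      2 * q + q * 1                      ≤⟨ +-monoʳ-≤ (2 * q) (m≤m+n (q * 1) (toℕ k′)) ⟩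
      2 * q + (q * 1 + toℕ k′)           ≡⟨ index-1 1F k′ ⟨
      index (1F , 1F , k′)               ∎)) (m≤n+m _ _))
    where open ≤-Reasoning

  opaque
    unfolding index
    subadditive : Subadditive flag X
    subadditive = subadditive-off-zero flag X go
      where
      go : ∀ x y → 1 ≤ index x → 1 ≤ index y → X (index (x ∙ y)) ≤ X (index x) + X (index y)
      go (0F , e , k) (0F , e′ , k′) x≥1 y≥1 = subadditive-0 e k e′ k′ x≥1 y≥1
      go (0F , e , k) (1F , e′ , k′) _   _   = subadditive-01 e k e′ k′
      go x@(1F , e , k) y@(0F , e′ , k′) _ _ = subst₂ _≤_
        (cong (X ∘ toℕ) (Flag.index-cong flag (AbelianGroup.comm Whole y x)))
        (+-comm (X (index y)) (X (index x))) (subadditive-01 e′ k′ e k)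
      go (1F , z@(e , k)) (1F , e′ , k′) _ _ = ≤-trans (0-coset≤12 (e E₂.∙ e′ , k K.∙ k′)) (≤-trans (1-coset≥12 z) (m≤m+n _ _))

  opaque
    unfolding X
    obstruction : Prime q → ∀ ps → All Prime ps → 2 * (2 * q) ≤ product ps → Closed ps (2 * (2 * q)) →
                  ¬ TowerSubadditive ps (2 * (2 * q)) X
    obstruction prq []       _          n≤1 _ = contradiction n≤1 λ { (s≤s ()) }
    obstruction prq (p ∷ ps) (pr ∷ prs) n≤Π closed
      with prime∣2^* 2 q pr (subst (p ∣_) (sym (*-assoc 2 2 q)) (closed-head∣ pr prs (s≤s (s≤s z≤n)) n≤Π closed))
    -- The jump at the odd number 3q = 1 + 2(3h + 1) excludes the first radix 2.
    ... | inj₁ refl = even-head-obstruction s t j ps 4≤s s+2≤t (t≡1+2j h) prs j<Π 3q≤4q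
      where
      j : ℕ
      j = 3 * h + 1
      t≡1+2j : ∀ h → 3 * (1 + 2 * h) ≡ 1 + 2 * (3 * h + 1)
      t≡1+2j = solve-∀
      2q≡j+1+h : ∀ h → 2 * (1 + 2 * h) ≡ 3 * h + 1 + (1 + h)
      2q≡j+1+h = solve-∀
      j<Π : j < product ps
      j<Π = <-≤-trans (subst (j <_) (sym (2q≡j+1+h h)) (m<m+n j (s≤s z≤n))) (*-cancelˡ-≤ {2 * q} 2 n≤Π)
      3q≤4q : t ≤ 2 * (2 * q)
      3q≤4q = subst (t ≤_) (*-assoc 2 2 q) (*-monoˡ-≤ q (n≤1+n 3))
    ... | inj₂ p∣q with refl ← prime∣prime pr prq p∣q =
          product-obstruction q t (q ∷ ps) 4≤s s+2≤t 3+q≤n sum-eq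
      where
      3+q≤n : 3 + q ≤ 2 * (2 * q)
      3+q≤n = ≤-trans s+2≤t (subst (t ≤_) (*-assoc 2 2 q) (*-monoˡ-≤ q (n≤1+n 3)))
      1<Π : 1 < product ps
      1<Π = <-≤-trans (s≤s (s≤s z≤n)) (*-cancelˡ-≤ {4} q (≤-trans (≤-reflexive (eq q)) n≤Π))
        where
        eq : ∀ q → q * 4 ≡ 2 * (2 * q)
        eq = solve-∀
      -- As 3 < q, the number 3 has only a first digit, while q has first digit 0 and second part 1.
      sum-eq : mulH (q ∷ ps) 3 q ≡ 3 + q
      sum-eq = begin
        mulH (q ∷ ps) 3 q                  ≡⟨ cong₂ (mulH (q ∷ ps)) (cong (3 +_) (*-zeroʳ q)) (*-identityʳ q) ⟨
        mulH (q ∷ ps) (3 + q * 0) (q * 1)  ≡⟨ mulH-no-carry q ps {3} {0} 0 1 (s≤s (≤-trans (n≤1+n 3) (*-monoʳ-≤ 2 {2} {h} (m≤m+n 2 h′)))) ⟩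
        3 + q * mulH ps 0 1                ≡⟨ cong (λ u → 3 + q * u) (mulH-identityˡ ps prs 1<Π) ⟩
        3 + q * 1                          ≡⟨ cong (3 +_) (*-identityʳ q) ⟩
        3 + q                              ∎
        where open ≡-Reasoning

  opaque
    unfolding X
    witness : Prime q → Witness (2 * (2 * q))
    witness prq = record
      { flag        = flag
      ; X           = X
      ; X-mono      = staircase-mono (steps s t)
      ; X-zero      = refl
      ; subadditive = subadditive
      ; obstruction = obstruction prq
      }

-- The case pqr

n≡0∨n≥1 : ∀ n → n ≡ 0 ⊎ 1 ≤ n
n≡0∨n≥1 zero    = inj₁ refl
n≡0∨n≥1 (suc _) = inj₂ (s≤s z≤n)

toℕ-⊕-≡ : ∀ m .{{_ : NonZero m}} x y {k l} → toℕ x ≡ k → toℕ y ≡ l → k + l < m →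
          toℕ (AbelianGroup._∙_ (cyclic m) x y) ≡ k + l
toℕ-⊕-≡ m x y refl refl k+l<m = ⊕-< m x y k+l<m

-- The elements are (c , b , a). Apart from 0 at the identity, the values are 1 if b = c = 0, else 3 for c = 0, 7 or 8 for c = 1 and 14 or 15 for c = 2,
-- the smaller one if a = 0, and 15 for c ≥ 3.
module ThreePrimes (p q r : ℕ) (prp : Prime p) (prq : Prime q) (prr : Prime r)
                   (p≢q : p ≢ q) (2<r : 2 < r) where
  private instance
    _ = prime⇒nonZero prp
    _ = prime⇒nonZero prq
    _ = prime⇒nonZero prr

  Base Whole : AbelianGroup 0ℓ 0ℓ
  Base  = cyclic p ⊗ cyclic q
  Whole = cyclic r ⊗ Base

  -- The subgroup c = 0 begins with the subgroup of order q, every other coset with a coset of the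
  -- subgroup of order p.
  E : Fin r → Enumeration Base (p * q)
  E c with toℕ c
  ... | zero  = lex
  ... | suc _ = colex

  module C = AbelianGroup (cyclic r)
  module B = AbelianGroup (cyclic p)
  module A = AbelianGroup (cyclic q)

  E-zero : ∀ c b a → toℕ c ≡ 0 → toℕ (Enumeration.index (E c) (b , a)) ≡ q * toℕ b + toℕ a
  E-zero c b a c≡0 with toℕ c
  E-zero c b a c≡0 | zero = toℕ-lex {p} {q} b a

  E-suc : ∀ c b a → 1 ≤ toℕ c → toℕ (Enumeration.index (E c) (b , a)) ≡ p * toℕ a + toℕ b
  E-suc c b a c≥1 with toℕ c
  E-suc c b a c≥1 | suc _ = toℕ-colex {p} {q} b a

  flag : Flag Whole (r * (p * q))
  flag = cosetwise-flag {G = Base} r E λ c c≡0 → trans (E-zero c B.ε A.ε c≡0)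
    (trans (cong₂ (λ u v → q * u + v) (toℕ-ε p) (toℕ-ε q)) (trans (+-identityʳ _) (*-zeroʳ q)))

  open AbelianGroup Whole using (_∙_; Carrier)

  pq : ℕ
  pq = p * q

  -- The values are 0, 1, 3, 7, 8, 14, 15. As 3 > 1 + 1 and 7 > 3 + 3, the sizes q and pq must be
  -- closed. The equality 14 = 7 + 7 permits the doubling in the group, while 15 > 7 + 7 obstructs
  -- the tuples.
  levels : List (ℕ × ℕ)
  levels = (1 , 1) ∷ (q , 2) ∷ (pq , 4) ∷ (pq + p , 1) ∷ (pq * 2 , 6) ∷ (pq * 2 + p , 1) ∷ []

  ascending : Ascending levels
  ascending = ℕ.>-nonZero⁻¹ q ∷ m≤n*m q p ∷ m≤m+n pq p
    ∷ ≤-trans (+-monoʳ-≤ pq (m≤m*n p q)) (≤-reflexive (eq pq)) ∷ m≤m+n (pq * 2) p ∷ [-]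
    where
    eq : ∀ m → m + m ≡ m * 2
    eq = solve-∀

  opaque
    X : ℕ → ℕ
    X = staircase levels

    lower : ∀ k {i} → proj₁ (lookup levels k) ≤ i → height levels k + proj₂ (lookup levels k) ≤ X i
    lower = staircase-lower ascending

    upper : ∀ k {i} → i < proj₁ (lookup levels k) → X i ≤ height levels k
    upper = staircase-upper levels

    X≤15 : ∀ i → X i ≤ 15
    X≤15 = staircase-≤-sum levels

    X-mono : Monotone X
    X-mono = staircase-mono levels

  opaque
    index : Fin r × Fin p × Fin q → ℕ
    index z = toℕ (Flag.index flag z)

    index-eq : ∀ c z → index (c , z) ≡ pq * toℕ c + toℕ (Enumeration.index (E c) z)
    index-eq = toℕ-cosetwise {pq} {Base} E

    index-≥ : ∀ c z → pq * toℕ c ≤ index (c , z)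
    index-≥ = cosetwise-≥ {pq} {Base} E

    index-< : ∀ c z → index (c , z) < pq * suc (toℕ c)
    index-< = cosetwise-< {pq} {Base} E

  index-0 : ∀ c b a → toℕ c ≡ 0 → index (c , b , a) ≡ q * toℕ b + toℕ a
  index-0 c b a c≡0 = trans (index-eq c (b , a)) (cong₂ _+_ (trans (cong (pq *_) c≡0) (*-zeroʳ pq)) (E-zero c b a c≡0))

  index-suc : ∀ c b a → 1 ≤ toℕ c → index (c , b , a) ≡ pq * toℕ c + (p * toℕ a + toℕ b)
  index-suc c b a c≥1 = trans (index-eq c (b , a)) (cong (pq * toℕ c +_) (E-suc c b a c≥1))

  ≤3 : ∀ c z → toℕ c ≡ 0 → X (index (c , z)) ≤ 3
  ≤3 c z c≡0 = upper 2F (<-≤-trans (index-< c z) (≤-reflexive (trans (cong (λ u → pq * suc u) c≡0) (*-identityʳ pq))))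

  ≤8 : ∀ c z → toℕ c ≡ 1 → X (index (c , z)) ≤ 8
  ≤8 c z c≡1 = upper 4F (<-≤-trans (index-< c z) (≤-reflexive (cong (λ u → pq * suc u) c≡1)))

  ≥7 : ∀ c z → 1 ≤ toℕ c → 7 ≤ X (index (c , z))
  ≥7 c z c≥1 = lower 2F (≤-trans (≤-trans (≤-reflexive (sym (*-identityʳ pq))) (*-monoʳ-≤ pq c≥1)) (index-≥ c z))

  ≥14 : ∀ c z → 2 ≤ toℕ c → 14 ≤ X (index (c , z))
  ≥14 c z c≥2 = lower 4F (≤-trans (*-monoʳ-≤ pq c≥2) (index-≥ c z))

  ≥8 : ∀ c b a → 1 ≤ toℕ c → 1 ≤ toℕ a → 8 ≤ X (index (c , b , a))
  ≥8 c b a c≥1 a≥1 = lower 3F (subst (pq + p ≤_) (sym (index-suc c b a c≥1)) (+-mono-≤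
    (≤-trans (≤-reflexive (sym (*-identityʳ pq))) (*-monoʳ-≤ pq c≥1))
    (≤-trans (≤-trans (≤-reflexive (sym (*-identityʳ p))) (*-monoʳ-≤ p a≥1)) (m≤m+n _ _))))

  ≤14 : ∀ c b a → toℕ c ≡ 2 → toℕ a ≡ 0 → X (index (c , b , a)) ≤ 14
  ≤14 c b a c≡2 a≡0 = upper 5F (subst (_< pq * 2 + p) (sym (index-suc c b a (subst (1 ≤_) (sym c≡2) (s≤s z≤n)))) (begin-strict
    pq * toℕ c + (p * toℕ a + toℕ b)  ≡⟨ cong₂ (λ u v → pq * u + (p * v + toℕ b)) c≡2 a≡0 ⟩
    pq * 2 + (p * 0 + toℕ b)          ≡⟨ cong (λ u → pq * 2 + (u + toℕ b)) (*-zeroʳ p) ⟩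
    pq * 2 + toℕ b                    <⟨ +-monoʳ-< (pq * 2) (Finₚ.toℕ<n b) ⟩
    pq * 2 + p                        ∎))
    where open ≤-Reasoning

  ≥3 : ∀ c b a → toℕ c ≡ 0 → 1 ≤ toℕ b → 3 ≤ X (index (c , b , a))
  ≥3 c b a c≡0 b≥1 = lower 1F (subst (q ≤_) (sym (index-0 c b a c≡0))
    (≤-trans (≤-trans (≤-reflexive (sym (*-identityʳ q))) (*-monoʳ-≤ q b≥1)) (m≤m+n _ _)))

  ≤1 : ∀ c b a → toℕ c ≡ 0 → toℕ b ≡ 0 → X (index (c , b , a)) ≤ 1
  ≤1 c b a c≡0 b≡0 = upper 1F (subst (_< q) (sym (trans (index-0 c b a c≡0)
    (cong (_+ toℕ a) (trans (cong (q *_) b≡0) (*-zeroʳ q))))) (Finₚ.toℕ<n a))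

  -- Adding an element of the subgroup c = 0 keeps the coset of the other summand. If c′ ≥ 1, values
  -- within that coset differ by at most 1, which the nontrivial first summand pays for.
  subadditive-0* : ∀ c b a c′ b′ a′ → toℕ c ≡ 0 → 1 ≤ index (c , b , a) → 1 ≤ index (c′ , b′ , a′) →
    X (index (c C.∙ c′ , b B.∙ b′ , a A.∙ a′)) ≤ X (index (c , b , a)) + X (index (c′ , b′ , a′))
  subadditive-0* c b a c′ b′ a′ c≡0 z≥1 z′≥1 =
    go (toℕ c′) refl (trans (⊕-< r c c′ (subst (λ u → u + toℕ c′ < r) (sym c≡0) (Finₚ.toℕ<n c′))) (cong (_+ toℕ c′) c≡0))
    where
    go : ∀ k → toℕ c′ ≡ k → toℕ (c C.∙ c′) ≡ toℕ c′ →
         X (index (c C.∙ c′ , b B.∙ b′ , a A.∙ a′)) ≤ X (index (c , b , a)) + X (index (c′ , b′ , a′))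
    go zero c′≡0 cc′ = inner (n≡0∨n≥1 (toℕ b)) (n≡0∨n≥1 (toℕ b′))
      where
      inner : toℕ b ≡ 0 ⊎ 1 ≤ toℕ b → toℕ b′ ≡ 0 ⊎ 1 ≤ toℕ b′ →
        X (index (c C.∙ c′ , b B.∙ b′ , a A.∙ a′)) ≤ X (index (c , b , a)) + X (index (c′ , b′ , a′))
      inner (inj₂ b≥1) _           = ≤-trans (≤3 (c C.∙ c′) (b B.∙ b′ , a A.∙ a′) (trans cc′ c′≡0))
                                             (≤-trans (≥3 c b a c≡0 b≥1) (m≤m+n _ _))
      inner _          (inj₂ b′≥1) = ≤-trans (≤3 (c C.∙ c′) (b B.∙ b′ , a A.∙ a′) (trans cc′ c′≡0))
                                             (≤-trans (≥3 c′ b′ a′ c′≡0 b′≥1) (m≤n+m _ _))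
      inner (inj₁ b≡0) (inj₁ b′≡0) = ≤-trans
        (≤1 (c C.∙ c′) (b B.∙ b′) (a A.∙ a′) (trans cc′ c′≡0) (toℕ-⊕-≡ p b b′ b≡0 b′≡0 (ℕ.>-nonZero⁻¹ p)))
        (≤-trans (lower 0F z≥1) (m≤m+n _ _))
    go (suc zero) c′≡1 cc′ = ≤-trans (≤8 (c C.∙ c′) (b B.∙ b′ , a A.∙ a′) (trans cc′ c′≡1))
      (+-mono-≤ (lower 0F z≥1) (≥7 c′ (b′ , a′) (≤-reflexive (sym c′≡1))))
    go (suc (suc k)) c′≡ cc′ = ≤-trans (X≤15 _)
      (+-mono-≤ (lower 0F z≥1) (≥14 c′ (b′ , a′) (subst (2 ≤_) (sym c′≡) (s≤s (s≤s z≤n)))))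

  -- The two values add up to at least 15 unless c = c′ = 1 and a = a′ = 0. In that case the sum has
  -- c = 2, without reduction since r > 2, and a = 0, so its value is at most 14.
  subadditive-++ : ∀ c b a c′ b′ a′ → 1 ≤ toℕ c → 1 ≤ toℕ c′ →
    X (index (c C.∙ c′ , b B.∙ b′ , a A.∙ a′)) ≤ X (index (c , b , a)) + X (index (c′ , b′ , a′))
  subadditive-++ c b a c′ b′ a′ c≥1 c′≥1 with 2 ≤? toℕ c | 2 ≤? toℕ c′ | 1 ≤? toℕ a | 1 ≤? toℕ a′
  ... | yes c≥2 | _        | _       | _        = ≤-trans (X≤15 _) (≤-trans (m≤m+n 15 6) (+-mono-≤ (≥14 c (b , a) c≥2) (≥7 c′ (b′ , a′) c′≥1)))
  ... | no _    | yes c′≥2 | _       | _        = ≤-trans (X≤15 _) (≤-trans (m≤m+n 15 6) (+-mono-≤ (≥7 c (b , a) c≥1) (≥14 c′ (b′ , a′) c′≥2)))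
  ... | no _    | no _     | yes a≥1 | _        = ≤-trans (X≤15 _) (+-mono-≤ (≥8 c b a c≥1 a≥1) (≥7 c′ (b′ , a′) c′≥1))
  ... | no _    | no _     | no _    | yes a′≥1 = ≤-trans (X≤15 _) (+-mono-≤ (≥7 c (b , a) c≥1) (≥8 c′ b′ a′ c′≥1 a′≥1))
  ... | no c≱2  | no c′≱2  | no a≱1  | no a′≱1  = ≤-trans
      (≤14 (c C.∙ c′) (b B.∙ b′) (a A.∙ a′)
        (toℕ-⊕-≡ r c c′ (≤-antisym (≤-pred (≰⇒> c≱2)) c≥1) (≤-antisym (≤-pred (≰⇒> c′≱2)) c′≥1) 2<r)
        (toℕ-⊕-≡ q a a′ (n<1⇒n≡0 (≰⇒> a≱1)) (n<1⇒n≡0 (≰⇒> a′≱1)) (ℕ.>-nonZero⁻¹ q)))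
      (+-mono-≤ (≥7 c (b , a) c≥1) (≥7 c′ (b′ , a′) c′≥1))

  opaque
    unfolding index
    subadditive : Subadditive flag X
    subadditive = subadditive-off-zero flag X λ x@(c , b , a) y@(c′ , b′ , a′) x≥1 y≥1 →
      go c b a c′ b′ a′ x≥1 y≥1 (n≡0∨n≥1 (toℕ c)) (n≡0∨n≥1 (toℕ c′))
      where
      go : ∀ c b a c′ b′ a′ → 1 ≤ index (c , b , a) → 1 ≤ index (c′ , b′ , a′) →
           toℕ c ≡ 0 ⊎ 1 ≤ toℕ c → toℕ c′ ≡ 0 ⊎ 1 ≤ toℕ c′ →
           X (index ((c , b , a) ∙ (c′ , b′ , a′))) ≤ X (index (c , b , a)) + X (index (c′ , b′ , a′))
      go c b a c′ b′ a′ x≥1 y≥1 (inj₁ c≡0) _ = subadditive-0* c b a c′ b′ a′ c≡0 x≥1 y≥1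
      go c b a c′ b′ a′ x≥1 y≥1 (inj₂ _) (inj₁ c′≡0) = subst₂ _≤_
        (cong (X ∘ toℕ) (Flag.index-cong flag (AbelianGroup.comm Whole (c′ , b′ , a′) (c , b , a))))
        (+-comm (X (index (c′ , b′ , a′))) (X (index (c , b , a)))) (subadditive-0* c′ b′ a′ c b a c′≡0 y≥1 x≥1)
      go c b a c′ b′ a′ x≥1 y≥1 (inj₂ c≥1) (inj₂ c′≥1) = subadditive-++ c b a c′ b′ a′ c≥1 c′≥1

  pqr : ℕ
  pqr = r * pq

  pq≤pqr : pq ≤ pqr
  pq≤pqr = m≤n*m pq r

  -- The first two digits of pq + a are those of a, and the third is 1. Since r > 2, the third
  -- digits add up to 2, while the first two are added as in (q, p).
  mulH-doubling : ∀ ps → All Prime ps → ∀ a b → a < p → b < p →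
    mulH (q ∷ p ∷ r ∷ ps) (pq + a) (pq + b) ≡ pq * 2 + mulH (q ∷ p ∷ []) a b
  mulH-doubling ps prs a b a<p b<p = begin
    mulH (q ∷ p ∷ r ∷ ps) (pq + a) (pq + b)
      ≡⟨ cong₂ (mulH (q ∷ p ∷ r ∷ ps)) (split-shifted a) (split-shifted b) ⟩
    mulH (q ∷ p ∷ r ∷ ps) (a % q + q * (a / q + p * 1)) (b % q + q * (b / q + p * 1))
      ≡⟨ mulH-∷ q (p ∷ r ∷ ps) (a / q + p * 1) (b / q + p * 1) (m%n<n a q) (m%n<n b q) ⟩
    u + q * mulH (p ∷ r ∷ ps) (a / q + p * 1) (b / q + p * 1)
      ≡⟨ cong (λ h → u + q * h) (mulH-∷ p (r ∷ ps) 1 1 (≤-<-trans (m/n≤m a q) a<p) (≤-<-trans (m/n≤m b q) b<p)) ⟩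
    u + q * (v + p * mulH (r ∷ ps) 1 1)
      ≡⟨ cong (λ h → u + q * (v + p * h)) 1+1≡2 ⟩
    u + q * (v + p * 2)
      ≡⟨ rearrange u v p q ⟩
    pq * 2 + (u + q * (v + p * 0))
      ≡⟨ cong (λ h → pq * 2 + (u + q * h)) (mulH-∷ p [] 0 0 (≤-<-trans (m/n≤m a q) a<p) (≤-<-trans (m/n≤m b q) b<p)) ⟨
    pq * 2 + (u + q * mulH (p ∷ []) (a / q + p * 0) (b / q + p * 0))
      ≡⟨ cong (pq * 2 +_) (mulH-∷ q (p ∷ []) (a / q + p * 0) (b / q + p * 0) (m%n<n a q) (m%n<n b q)) ⟨
    pq * 2 + mulH (q ∷ p ∷ []) (a % q + q * (a / q + p * 0)) (b % q + q * (b / q + p * 0))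
      ≡⟨ cong (pq * 2 +_) (cong₂ (mulH (q ∷ p ∷ [])) (split a) (split b)) ⟨
    pq * 2 + mulH (q ∷ p ∷ []) a b ∎
    where
    open ≡-Reasoning
    u = modP q (a % q + b % q)
    v = modP p (a / q + b / q)
    rearrange : ∀ u v p q → u + q * (v + p * 2) ≡ p * q * 2 + (u + q * (v + p * 0))
    rearrange = solve-∀
    split : ∀ a → a ≡ a % q + q * (a / q + p * 0)
    split a = trans (m≡m%n+[m/n]*n a q) (eq (a % q) (a / q) q p)
      where
      eq : ∀ x y q p → x + y * q ≡ x + q * (y + p * 0)
      eq = solve-∀
    split-shifted : ∀ a → pq + a ≡ a % q + q * (a / q + p * 1)
    split-shifted a = trans (cong (pq +_) (split a)) (eq (a % q) (a / q) q p)
      where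
      eq : ∀ x y q p → p * q + (x + q * (y + p * 0)) ≡ x + q * (y + p * 1)
      eq = solve-∀
    1+1≡2 : mulH (r ∷ ps) 1 1 ≡ 2
    1+1≡2 = begin
      mulH (r ∷ ps) 1 1                      ≡⟨ cong (λ h → mulH (r ∷ ps) h h) (cong (1 +_) (*-zeroʳ r)) ⟨
      mulH (r ∷ ps) (1 + r * 0) (1 + r * 0)  ≡⟨ mulH-no-carry r ps {1} {1} 0 0 2<r ⟩
      2 + r * mulH ps 0 0                    ≡⟨ cong (λ h → 2 + r * h) (mulH-identityˡ ps prs (productOfPrimes≥1 prs)) ⟩
      2 + r * 0                              ≡⟨ cong (2 +_) (*-zeroʳ r) ⟩
      2                                      ∎

  module _ ps (tower : TowerSubadditive ps pqr X) where

    closed-level : ∀ s v → s ≤ pqr → (∀ {i} → i < s → X i ≤ v) → (∀ {i} → s ≤ i → v + v < X i) → Closed ps s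
    closed-level s v s≤pqr small large a b a<s b<s with <-≤-connex (mulH ps a b) s
    ... | inj₁ p = p
    ... | inj₂ p = contradiction (<-≤-trans (large p) (≤-trans (tower a b (<-≤-trans a<s s≤pqr) (<-≤-trans b<s s≤pqr))
                     (+-mono-≤ (small a<s) (small b<s)))) (<-irrefl refl)

    closed-q : Closed ps q
    closed-q = closed-level q 1 (≤-trans (m≤n*m q p) pq≤pqr) (upper 1F) (lower 1F)

    closed-pq : Closed ps pq
    closed-pq = closed-level pq 3 pq≤pqr (upper 2F) (lower 2F)

  -- The positions pq + a with a < p have value at most 7, so their sums stay below 2pq + p, where
  -- the value is 15. Hence {0,...,p-1} would be closed for (q, p), forcing q = p.
  not-tower : ∀ ps → All Prime ps → ¬ TowerSubadditive (q ∷ p ∷ r ∷ ps) pqr X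
  not-tower ps prs tower = p≢q (sym (closed-prime {ps = p ∷ []} prq (prp ∷ []) prp p≤qp closed-p))
    where
    p≤qp : p ≤ q * (p * 1)
    p≤qp = ≤-trans (m≤n*m p q) (≤-reflexive (cong (q *_) (sym (*-identityʳ p))))
    pq+p≤pqr : pq + p ≤ pqr
    pq+p≤pqr = ≤-trans (+-monoʳ-≤ pq (m≤m*n p q)) (≤-trans (≤-reflexive (eq pq)) (*-monoˡ-≤ pq (<⇒≤ 2<r)))
      where
      eq : ∀ m → m + m ≡ 2 * m
      eq = solve-∀
    closed-p : Closed (q ∷ p ∷ []) p
    closed-p a b a<p b<p with <-≤-connex (mulH (q ∷ p ∷ []) a b) p
    ... | inj₁ m<p = m<p
    ... | inj₂ p≤m = contradiction (begin
      15                                            ≤⟨ lower 5F (+-monoʳ-≤ (pq * 2) p≤m) ⟩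
      X (pq * 2 + mulH (q ∷ p ∷ []) a b)            ≡⟨ cong X (mulH-doubling ps prs a b a<p b<p) ⟨
      X (mulH (q ∷ p ∷ r ∷ ps) (pq + a) (pq + b))   ≤⟨ tower (pq + a) (pq + b) (<-≤-trans (+-monoʳ-< pq a<p) pq+p≤pqr) (<-≤-trans (+-monoʳ-< pq b<p) pq+p≤pqr) ⟩
      X (pq + a) + X (pq + b)                       ≤⟨ +-mono-≤ (upper 3F (+-monoʳ-< pq a<p)) (upper 3F (+-monoʳ-< pq b<p)) ⟩
      14                                            ∎) 1+n≰n
      where open ≤-Reasoning

  -- The closed sizes q, pq, pqr reveal the radices in turn. The first is q; division by q leaves
  -- the sizes p and rp, so the second is p; division by p leaves r, which is the third.
  obstruction : ∀ ps → All Prime ps → pqr ≤ product ps → Closed ps pqr → ¬ TowerSubadditive ps pqr X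
  obstruction []       _ pqr≤1 _ _ = contradiction (≤-trans (m≤m*n r pq {{m*n≢0 p q}}) pqr≤1) (<⇒≱ (<-trans (s≤s (s≤s z≤n)) 2<r))
  obstruction (p₁ ∷ ps₁) (pr₁ ∷ prs₁) pqr≤Π closed-pqr tower
    with refl ← closed-prime pr₁ prs₁ prq (≤-trans (≤-trans (m≤n*m q p) pq≤pqr) pqr≤Π) (closed-q (p₁ ∷ ps₁) tower)
    with s , eq , closed ← closed-∷ pr₁ prs₁ (≤-trans (prime>1 prp) (m≤m*n p q)) (≤-trans pq≤pqr pqr≤Π) (closed-pq (q ∷ ps₁) tower)
    with refl ← *-cancelʳ-≡ s p q (trans (*-comm s q) (sym eq))
    with s′ , eq′ , closed′ ← closed-∷ pr₁ prs₁ (≤-trans (<⇒≤ 2<r) (m≤m*n r pq {{m*n≢0 p q}})) pqr≤Π closed-pqr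
    with refl ← *-cancelʳ-≡ s′ (r * p) q (trans (*-comm s′ q) (trans (sym eq′) (sym (*-assoc r p q))))
    = second ps₁ prs₁ tower closed closed′
        (*-cancelʳ-≤ (r * p) _ q (subst₂ _≤_ (sym (*-assoc r p q)) (*-comm q (product ps₁)) pqr≤Π))
    where
    third : ∀ ps → All Prime ps → TowerSubadditive (q ∷ p ∷ ps) pqr X → Closed ps r → ¬ (r ≤ product ps)
    third []        _          _     _      r≤1 = contradiction r≤1 (<⇒≱ (<-trans (s≤s (s≤s z≤n)) 2<r))
    third (p₃ ∷ ps) (pr ∷ prs) tower closed r≤Π
      with refl ← closed-prime pr prs prr r≤Π closed = not-tower ps prs tower
    second : ∀ ps → All Prime ps → TowerSubadditive (q ∷ ps) pqr X → Closed ps p → Closed ps (r * p) → ¬ (r * p ≤ product ps)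
    second []        _          _     _        _         rp≤1 =
      contradiction (≤-trans (m≤m*n r p) rp≤1) (<⇒≱ (<-trans (s≤s (s≤s z≤n)) 2<r))
    second (p₂ ∷ ps) (pr ∷ prs) tower closed-p closed-rp rp≤Π
      with refl ← closed-prime pr prs prp (≤-trans (m≤n*m p r) rp≤Π) closed-p
      with s , eq , closed-r ← closed-∷ pr prs (≤-trans (<⇒≤ 2<r) (m≤m*n r p)) rp≤Π closed-rp
      with refl ← *-cancelʳ-≡ s r p (trans (*-comm s p) (sym eq))
      = third ps prs tower closed-r (*-cancelʳ-≤ r _ p (subst (r * p ≤_) (*-comm p (product ps)) rp≤Π))

  opaque
    unfolding X
    X-zero : X 0 ≡ 0
    X-zero = refl

  witness : Witness pqr
  witness = record
    { flag        = flag
    ; X           = X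
    ; X-mono      = X-mono
    ; X-zero      = X-zero
    ; subadditive = subadditive
    ; obstruction = obstruction
    }

-- Arithmetic of n

power⊎other-prime : ∀ p ps → All Prime ps → (∃ λ k → product ps ≡ p ^ k) ⊎ (∃ λ q → Prime q × p ≢ q × q ∣ product ps)
power⊎other-prime p []       []         = inj₁ (0 , refl)
power⊎other-prime p (q ∷ ps) (prq ∷ prs) with p ≟ q | power⊎other-prime p ps prs
... | no p≢q   | _                          = inj₂ (q , prq , p≢q , m∣m*n (product ps))
... | yes refl | inj₁ (k , eq)              = inj₁ (suc k , cong (p *_) eq)
... | yes refl | inj₂ (r , prr , p≢r , r∣Π) = inj₂ (r , prr , p≢r , ∣n⇒∣m*n p r∣Π)

1⊎prime-factor : ∀ n .{{_ : NonZero n}} → n ≡ 1 ⊎ (∃₂ λ p m → Prime p × NonZero m × n ≡ p * m)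
1⊎prime-factor n with factorise n
... | record { factors = []     ; isFactorisation = eq } = inj₁ eq
... | record { factors = p ∷ ps ; isFactorisation = eq ; factorsPrime = pr ∷ prs } =
  inj₂ (p , product ps , pr , ℕ.>-nonZero (productOfPrimes≥1 prs) , eq)

odd-prime : ∀ {p} → Prime p → p ≢ 2 → ∃ λ h → p ≡ 1 + 2 * h
odd-prime {p} pr p≢2 with p % 2 in eq | m≡m%n+[m/n]*n p 2 | m%n<n p 2
... | 0           | p≡ | _              = contradiction (sym (prime∣prime prime[2] pr (divides (p / 2) p≡))) p≢2
... | 1           | p≡ | _              = p / 2 , trans p≡ (cong suc (*-comm (p / 2) 2))
... | suc (suc _) | _  | s≤s (s≤s ())

-- Case distinction on the prime factors

uncovered-pqr : ∀ m p q r → NonZero m → Prime p → Prime q → Prime r → p ≢ q → r ≢ 2 → Uncovered (m * (r * (p * q)))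
uncovered-pqr m p q r m≢0 prp prq prr p≢q r≢2 = witness⇒uncovered m (r * (p * q)) {{m≢0}} {{m*n≢0 r (p * q)}}
  (ThreePrimes.witness p q r prp prq prr p≢q (≤∧≢⇒< (prime>1 prr) (r≢2 ∘ sym)))
  where
  instance
    _ = prime⇒nonZero prr
    pq≢0 : NonZero (p * q)
    pq≢0 = m*n≢0 p q {{prime⇒nonZero prp}} {{prime⇒nonZero prq}}

-- A proper multiple of 12 is a multiple of 24 or of 2 · 3 · p with an odd prime p, possibly 3.
uncovered-12 : ∀ m → NonZero m → m * 12 ≢ 12 → Uncovered (m * 12)
uncovered-12 m m≢0 ≢12 with 1⊎prime-factor m {{m≢0}}
... | inj₁ refl = contradiction refl ≢12
... | inj₂ (p , m′ , pr , m′≢0 , refl) with p ≟ 2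
...   | yes refl = subst Uncovered (eq m′) (witness⇒uncovered m′ 24 {{m′≢0}} witness₂₄)
  where
  eq : ∀ m′ → m′ * 24 ≡ 2 * m′ * 12
  eq = solve-∀
...   | no p≢2   = subst Uncovered (eq m′ p)
        (uncovered-pqr (m′ * 2) 2 3 p (m*n≢0 m′ 2 {{m′≢0}}) prime[2] prime[3] pr (λ ()) p≢2)
  where
  eq : ∀ m′ p → m′ * 2 * (p * 6) ≡ p * m′ * 12
  eq = solve-∀

uncovered-4q : ∀ m q → NonZero m → Prime q → q ≢ 2 → m * (2 * (2 * q)) ≢ 12 → Uncovered (m * (2 * (2 * q)))
uncovered-4q m q m≢0 prq q≢2 ≢12 with odd-prime prq q≢2
... | 0             , refl = contradiction (prime>1 prq) (<-irrefl refl)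
-- Here q = 3, so 4q = 12.
... | 1             , refl = uncovered-12 m m≢0 ≢12
... | suc (suc h′)  , refl = witness⇒uncovered m (2 * (2 * q)) {{m≢0}} (FourPrimes.witness h′ prq)

-- If r is odd, the case pqr applies directly. If r = 2 and p or q is 2 as well, 4 times an odd
-- prime divides n. If p and q are both odd, 2 and p serve as the distinct primes and q as the odd
-- third one.
uncovered : ∀ m p q r → NonZero m → Prime p → Prime q → Prime r → p ≢ q → m * (r * (p * q)) ≢ 12 →
            Uncovered (m * (r * (p * q)))
uncovered m p q r m≢0 prp prq prr p≢q ≢12 with r ≟ 2 | p ≟ 2 | q ≟ 2
... | no r≢2   | _        | _        = uncovered-pqr m p q r m≢0 prp prq prr p≢q r≢2
... | yes refl | yes refl | _        = uncovered-4q m q m≢0 prq (p≢q ∘ sym) ≢12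
... | yes refl | no p≢2   | yes refl = subst Uncovered (cong (λ k → m * (2 * k)) (*-comm 2 p))
        (uncovered-4q m p m≢0 prp p≢2 (≢12 ∘ trans (cong (λ k → m * (2 * k)) (*-comm p 2))))
... | yes refl | no p≢2   | no q≢2   = subst Uncovered (eq m p q)
        (uncovered-pqr m 2 p q m≢0 prime[2] prp prq (p≢2 ∘ sym) q≢2)
  where
  eq : ∀ m p q → m * (q * (2 * p)) ≡ m * (2 * (p * q))
  eq = solve-∀

theorem6p1 : (n : ℕ) → 2 ≤ n →
    ¬ (∃ λ p → ∃ λ k → Prime p × 1 ≤ k × n ≡ p ^ k) →
    ¬ (∃ λ p → ∃ λ q → Prime p × Prime q × p ≢ q × n ≡ p * q) →
    n ≢ 12 →
    Σ (FlagType n) λ T → Realizable T ×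
    (∃ λ (x : Fin n → Q.ℚ) → InP (FlagType.T T) x ×
    ((ps : List ℕ) → All Prime ps → product ps ≡ n →
    (T' : Fin n → Fin n → Fin n) → IsTp ps T' → ¬ InP T' x))
theorem6p1 n 2≤n ¬power ¬pq n≢12 with factorise n {{ℕ.>-nonZero (<⇒≤ 2≤n)}}
... | record { factors = [] ; isFactorisation = refl } = contradiction 2≤n 1+n≰n
... | record { factors = p ∷ ps ; isFactorisation = n≡ ; factorsPrime = prp ∷ prs }
    with power⊎other-prime p (p ∷ ps) (prp ∷ prs)
...   | inj₁ (zero  , Π≡1)  = contradiction (subst (2 ≤_) (trans n≡ Π≡1) 2≤n) 1+n≰n
...   | inj₁ (suc k , Π≡p^) = contradiction (p , suc k , prp , s≤s z≤n , trans n≡ Π≡p^) ¬power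
...   | inj₂ (q , prq , p≢q , q∣Π) with euclidsLemma p (product ps) prq q∣Π
...     | inj₁ q∣p = contradiction (sym (prime∣prime prq prp q∣p)) p≢q
-- Now n = p q m. The case m = 1 is excluded by `¬pq`; otherwise a prime factor r of m makes n a
-- multiple of pqr.
...     | inj₂ (divides m Π≡m*q) with 1⊎prime-factor m {{m≢0}}
  where
  m≢0 : NonZero m
  m≢0 = m*n≢0⇒m≢0 m {{subst NonZero Π≡m*q (ℕ.>-nonZero (productOfPrimes≥1 prs))}}
...       | inj₁ refl = contradiction (p , q , prp , prq , p≢q , trans n≡ (cong (p *_) (trans Π≡m*q (*-identityˡ q)))) ¬pq
...       | inj₂ (r , m′ , prr , m′≢0 , refl) =
  subst Uncovered (sym n≡′) (uncovered m′ p q r m′≢0 prp prq prr p≢q (n≢12 ∘ trans n≡′))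
  where
  rearrange : ∀ p q r m′ → p * (r * m′ * q) ≡ m′ * (r * (p * q))
  rearrange = solve-∀
  n≡′ : n ≡ m′ * (r * (p * q))
  n≡′ = trans n≡ (trans (cong (p *_) Π≡m*q) (rearrange p q r m′))
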